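{- Let $\Delta\ge 1$, $\varepsilon>0$, and let $(G=(V,E),\mathcal L)$ be a $((1+\varepsilon)\Delta+1)$-extra list edge coloring instance where $G$ has maximum degree at most $\Delta$, and let $\mu$ be the uniform distribution on its proper edge colorings. Then for every edge $i\in E$ and all colors $a,b\in\mathcal L(i)$, \[\mathcal W_1\big(\mu_E^{i\leftarrow a},\mu_E^{i\leftarrow b}\big)\le 1+\frac{2}{\varepsilon},\] i.e. $\mu$ is $(1+2/\varepsilon)$-coupling independent in this sense.
   Context: A list edge coloring instance is a pair $(G,\mathcal L)$, $G=(V,E)$ a finite undirected graph, $\mathcal L(e)\subseteq[q]$ a color list for each $e\in E$. For $e\in E$, $\deg(e)$ is the number of edges other than $e$ sharing an endpoint with $e$. A proper edge coloring is $\sigma:E\to[q]$ with $\sigma(e)\in\mathcal L(e)$ and $\sigma(e_1)\neq\sigma(e_2)$ for distinct edges sharing an endpoint. The instance is $\beta$-extra if $|\mathcal L(e)|\ge\deg(e)+\beta$ for all $e$. For a pinning $i\leftarrow c$, $\mu^{i\leftarrow c}$ denotes $\mu$ conditioned on edge $i$ receiving color $c$, and $\mu^{i\leftarrow c}_S$ its marginal on the edge set $S$. For distributions $\nu_1,\nu_2$ on a finite set with metric $d$, $\mathcal W_1(\nu_1,\nu_2)=\inf_{\omega}\mathbb E_{(x,y)\sim\omega}[d(x,y)]$ over all couplings $\omega$ of $\nu_1,\nu_2$; here $d$ is the Hamming distance (number of edges colored differently).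
   Formalization: The parameter ε is taken to be a positive rational rather than a positive real; the bound on the Wasserstein distance is given by exhibiting a rational-valued coupling that attains it. -}

module Defs where

open import Data.Nat as ℕ using (ℕ; zero; suc)
open import Data.Fin as Fin using (Fin)
open import Data.Fin.Properties using (all?; any?)
open import Data.Fin.Subset using (Subset; _∈_; ∣_∣)
open import Data.Fin.Subset.Properties using (_∈?_)
open import Data.Vec as Vec using (Vec; []; _∷_; lookup)
open import Data.List as List using (List; []; _∷_; length; filter; concatMap; allFin; map)
open import Data.Product using (_×_; _,_; proj₁; proj₂)
open import Data.Sum using (_⊎_)
open import Data.Integer using (+_)
open import Data.Rational as ℚ using (ℚ; 0ℚ; 1ℚ; _+_; _*_)
open import Relation.Nullary using (¬_; Dec; yes; no)
open import Relation.Nullary.Decidable using (_×-dec_; _⊎-dec_; _→-dec_; ¬?)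
open import Relation.Binary.PropositionalEquality using (_≡_; _≢_)
open import Relation.Unary using (Pred; Decidable)
import Agda.Primitive

record Graph (n m : ℕ) : Set where
  field
    ends     : Fin m → Fin n × Fin n
    loopless : ∀ e → proj₁ (ends e) ≢ proj₂ (ends e)
    simple   : ∀ e f → ends e ≡ ends f ⊎ ends e ≡ (proj₂ (ends f) , proj₁ (ends f)) → e ≡ f
open Graph public

module _ {n m : ℕ} (G : Graph n m) where

  Incident : Fin m → Fin n → Set
  Incident e v = proj₁ (ends G e) ≡ v ⊎ proj₂ (ends G e) ≡ v

  incident? : ∀ e v → Dec (Incident e v)
  incident? e v = (proj₁ (ends G e) Fin.≟ v) ⊎-dec (proj₂ (ends G e) Fin.≟ v)

  Adjacent : Fin m → Fin m → Set
  Adjacent e f = (e ≢ f) × (Incident f (proj₁ (ends G e)) ⊎ Incident f (proj₂ (ends G e)))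

  adjacent? : ∀ e f → Dec (Adjacent e f)
  adjacent? e f = ¬? (e Fin.≟ f) ×-dec (incident? f (proj₁ (ends G e)) ⊎-dec incident? f (proj₂ (ends G e)))

count : ∀ {k} {P : Pred (Fin k) Agda.Primitive.lzero} → Decidable P → ℕ
count P? = length (filter P? (allFin _))

module _ {n m : ℕ} (G : Graph n m) where

  vdeg : Fin n → ℕ
  vdeg v = count (λ e → incident? G e v)

  edeg : Fin m → ℕ
  edeg e = count (adjacent? G e)

  MaxDegreeAtMost : ℕ → Set
  MaxDegreeAtMost Δ = ∀ v → vdeg v ℕ.≤ Δ

Coloring : ℕ → ℕ → Set
Coloring m q = Vec (Fin q) m

allColorings : ∀ m q → List (Coloring m q)
allColorings zero    q = [] ∷ []
allColorings (suc m) q = concatMap (λ σ → map (_∷ σ) (allFin q)) (allColorings m q)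

module _ {n m q : ℕ} (G : Graph n m) (L : Fin m → Subset q) where

  Proper : Coloring m q → Set
  Proper σ = (∀ e → lookup σ e ∈ L e) × (∀ e f → Adjacent G e f → lookup σ e ≢ lookup σ f)

  proper? : ∀ σ → Dec (Proper σ)
  proper? σ = all? (λ e → lookup σ e ∈? L e)
        ×-dec all? (λ e → all? (λ f → adjacent? G e f →-dec ¬? (lookup σ e Fin.≟ lookup σ f)))

  Pinned : Fin m → Fin q → Coloring m q → Set
  Pinned i c σ = Proper σ × lookup σ i ≡ c

  pinned? : ∀ i c σ → Dec (Pinned i c σ)
  pinned? i c σ = proper? σ ×-dec (lookup σ i Fin.≟ c)

-- 1/k as a rational (0 for k = 0, which never occurs for a nonempty support)
inv : ℕ → ℚ
inv zero    = 0ℚ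
inv (suc k) = (+ 1) ℚ./ suc k

uniformOn : ∀ {m q} {P : Pred (Coloring m q) Agda.Primitive.lzero} → Decidable P → Coloring m q → ℚ
uniformOn {m} {q} P? σ with P? σ
... | yes _ = inv (length (filter P? (allColorings m q)))
... | no  _ = 0ℚ

module _ {n m q : ℕ} (G : Graph n m) (L : Fin m → Subset q) where

  -- μ^{i←c}: the uniform distribution μ on proper colorings conditioned on
  -- edge i receiving color c (= uniform on the pinned proper colorings)
  μpin : Fin m → Fin q → Coloring m q → ℚ
  μpin i c = uniformOn (pinned? G L i c)

sumℚ : List ℚ → ℚ
sumℚ = List.foldr _+_ 0ℚ

hamming : ∀ {m q} → Coloring m q → Coloring m q → ℕ
hamming σ τ = count (λ e → ¬? (lookup σ e Fin.≟ lookup τ e))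

module _ {m q : ℕ} where

  record IsCoupling (ν₁ ν₂ : Coloring m q → ℚ) (ω : Coloring m q → Coloring m q → ℚ) : Set where
    field
      nonneg : ∀ σ τ → 0ℚ ℚ.≤ ω σ τ
      marg₁  : ∀ σ → sumℚ (map (ω σ) (allColorings m q)) ≡ ν₁ σ
      marg₂  : ∀ τ → sumℚ (map (λ σ → ω σ τ) (allColorings m q)) ≡ ν₂ τ

  cost : (Coloring m q → Coloring m q → ℚ) → ℚ
  cost ω = sumℚ (map (λ σ → sumℚ (map (λ τ → ω σ τ * (+ hamming σ τ ℚ./ 1)) (allColorings m q))) (allColorings m q))

  -- W₁(ν₁, ν₂) ≤ r  (the infimum over couplings is attained; an optimal
  -- coupling can be taken rational since it is an LP with rational data)
  W₁≤ : (ν₁ ν₂ : Coloring m q → ℚ) → ℚ → Set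
  W₁≤ ν₁ ν₂ r = Σ (Coloring m q → Coloring m q → ℚ) (λ ω → IsCoupling ν₁ ν₂ ω × cost ω ℚ.≤ r)
    where open import Data.Product using (Σ)

-- Pin the two ends of an edge separately: changing the colour that a pinned edge shows at one end u from a to b
-- should cost at most F = 1/ε, so that recolouring the edge costs 1 + 2F. Let Z be the colourings in which no
-- free edge at u uses a or b, and let B j (A j) be those in which the free edge j at u uses b (a). Then the two
-- sets of colourings are Z ∪ ⋃ B j and Z ∪ ⋃ A j, and recolouring j shows β ∣B j∣, β ∣A j∣ ≤ ∣Z∣ with β ≥ (1+ε)Δ.
-- Say the second set is the smaller one. Match Z to itself, as much as possible of B j to A j (cost 1 + F: only
-- the far end of j changes), the rest of the A l to B j with j ≠ l (cost 2 + 3F), and what is left over of the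
-- B j to the uniform distribution on the whole second set (cost 1 + 2F: j goes from b to some c, so at u the
-- colours a, b become b, c, which is again a single change). The costs refer to smaller instances, and they
-- add up to at most F because at most Δ edges meet u and Δ (1 + F) ≤ β F.
module Submission where

open import Defs
open import Data.Fin using (Fin)
open import Data.Fin.Subset using (Subset; _∈_; ∣_∣)
open import Data.Bool as Bool using (Bool; true; false; if_then_else_)
open import Data.Fin using (zero; suc; _≟_)
open import Data.Fin.Properties using (suc-injective; all?; any?; nonZeroIndex)
open import Data.Fin.Subset using (inside; outside)
open import Data.Fin.Subset.Properties using (_∈?_)
import Data.Integer.Properties as ℤ
open import Data.List as List using (List; []; _∷_; _++_; concatMap; allFin; filter; length; tabulate)
open import Data.List.Properties using (length-map)
import Data.List.Membership.DecPropositional as DecMembership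
open import Data.List.Membership.Propositional using () renaming (_∈_ to _∈ₗ_)
open import Data.List.Membership.Propositional.Properties using (∈-map⁺; ∈-filter⁺; ∈-allFin)
open import Data.List.Relation.Unary.Any using (here; there)
open import Data.Nat.Coprimality using (Coprime)
open import Data.Product using (_×_; _,_; proj₁; proj₂; ∃)
import Data.Rational.Properties as ℚ
open import Data.Rational.Solver using (module +-*-Solver)
open import Data.Rational.Unnormalised as ℚᵘ using (mkℚᵘ; *≡*; *≤*)
import Data.Rational.Unnormalised.Properties as ℚᵘ
open import Data.Sum using (_⊎_; inj₁; inj₂; [_,_]′)
open import Data.Vec as Vec using ([]; _∷_; lookup; _[_]≔_)
open import Data.Vec.Properties using (≡-dec; ∷-injective; lookup∘update; lookup∘update′; []≔-idempotent; []≔-lookup)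
open import Function using (_∘_; id)
open import Level using (0ℓ)
open import Relation.Binary using (DecidableEquality)
open import Relation.Binary.PropositionalEquality hiding (J)
open import Relation.Nullary using (¬_; Dec; yes; no; does; contradiction)
open import Relation.Nullary.Decidable using (¬?; _×-dec_; _→-dec_; map′; dec-true; dec-false)
open import Relation.Unary using (Pred; Decidable)

-- All transport is carried out in natural numbers. Let `v` and `F` be the numerator and the
-- denominator of ε. With the Hamming distance multiplied by `v`, the price 1/ε of a half edge is
-- the integer `F`, and `β` is (1+ε)Δ rounded up, which costs nothing because list sizes are
-- integers. Measures stay unnormalised: the sets Z, A j and B j are plain indicator functions, and
-- normalising is cross-multiplication by masses. The recursion closes because recolouring whole
-- edges is avoided. After j is pinned on both sides, its far end is changed first, and what is left
-- at u merges with the discrepancy already there into at most one change; each such change is again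
-- a half-edge problem with fewer free edges. A pinned edge, even with two different colours at its
-- ends, takes only one colour from each neighbour, since two edges of a simple graph share at most
-- one vertex. So one list bound, stated for the original graph, serves every instance of the
-- recursion. The value 1/ε is the solution F of Δ (1 + F) = (1 + ε) Δ F.

module Coupled where

  open import Data.Nat using (ℕ; zero; suc; _+_; _*_; _∸_; _≤_; _<_; z≤n; s≤s; s≤s⁻¹; NonZero)
  open import Data.Nat.Properties hiding (_≟_; suc-injective)
  open import Data.Nat.Tactic.RingSolver using (solve-∀)

  -- Indicators and finite sums of natural numbers.

  private variable
    A A′ : Set

  ⟦_⟧ : Dec A → ℕ
  ⟦ d ⟧ = if does d then 1 else 0

  ⟦⟧-yes : (d : Dec A) → A → ⟦ d ⟧ ≡ 1
  ⟦⟧-yes d a rewrite dec-true d a = refl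

  ⟦⟧-no : (d : Dec A) → ¬ A → ⟦ d ⟧ ≡ 0
  ⟦⟧-no d ¬a rewrite dec-false d ¬a = refl

  ⟦⟧-mono : (d : Dec A) (d′ : Dec A′) → (A → A′) → ⟦ d ⟧ ≤ ⟦ d′ ⟧
  ⟦⟧-mono (yes a) d′ f = ≤-reflexive (sym (⟦⟧-yes d′ (f a)))
  ⟦⟧-mono (no _)  d′ f = z≤n

  ⟦⟧-cong : (d : Dec A) (d′ : Dec A′) → (A → A′) → (A′ → A) → ⟦ d ⟧ ≡ ⟦ d′ ⟧
  ⟦⟧-cong d d′ f g = ≤-antisym (⟦⟧-mono d d′ f) (⟦⟧-mono d′ d g)

  ⟦⟧-* : (d : Dec A) (d′ : Dec A′) → ⟦ d ×-dec d′ ⟧ ≡ ⟦ d ⟧ * ⟦ d′ ⟧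
  ⟦⟧-* (yes _) d′ = sym (+-identityʳ _)
  ⟦⟧-* (no _)  d′ = refl

  ⟦⟧≤1 : (d : Dec A) → ⟦ d ⟧ ≤ 1
  ⟦⟧≤1 (yes _) = ≤-refl
  ⟦⟧≤1 (no _)  = z≤n

  ⟦⟧-idem : (d : Dec A) → ⟦ d ⟧ * ⟦ d ⟧ ≡ ⟦ d ⟧
  ⟦⟧-idem (yes _) = refl
  ⟦⟧-idem (no _)  = refl

  ∑ : List A → (A → ℕ) → ℕ
  ∑ []       f = 0
  ∑ (x ∷ xs) f = f x + ∑ xs f

  ∑-cong : ∀ (xs : List A) {f g : A → ℕ} → (∀ x → f x ≡ g x) → ∑ xs f ≡ ∑ xs g
  ∑-cong []       e = refl
  ∑-cong (x ∷ xs) e = cong₂ _+_ (e x) (∑-cong xs e)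

  ∑-mono : ∀ (xs : List A) {f g : A → ℕ} → (∀ x → f x ≤ g x) → ∑ xs f ≤ ∑ xs g
  ∑-mono []       e = z≤n
  ∑-mono (x ∷ xs) e = +-mono-≤ (e x) (∑-mono xs e)

  ∑-0 : ∀ (xs : List A) {f : A → ℕ} → (∀ x → f x ≡ 0) → ∑ xs f ≡ 0
  ∑-0 []       e = refl
  ∑-0 (x ∷ xs) e = cong₂ _+_ (e x) (∑-0 xs e)

  ∑-+ : ∀ (xs : List A) (f g : A → ℕ) → ∑ xs (λ x → f x + g x) ≡ ∑ xs f + ∑ xs g
  ∑-+ []       f g = refl
  ∑-+ (x ∷ xs) f g rewrite ∑-+ xs f g = interchange (f x) (g x) (∑ xs f) (∑ xs g)
    where
    interchange : ∀ a b c d → (a + b) + (c + d) ≡ (a + c) + (b + d)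
    interchange = solve-∀

  ∑-*ˡ : ∀ (xs : List A) k (f : A → ℕ) → ∑ xs (λ x → k * f x) ≡ k * ∑ xs f
  ∑-*ˡ []       k f = sym (*-zeroʳ k)
  ∑-*ˡ (x ∷ xs) k f rewrite ∑-*ˡ xs k f = sym (*-distribˡ-+ k (f x) (∑ xs f))

  ∑-*ʳ : ∀ (xs : List A) (f : A → ℕ) k → ∑ xs (λ x → f x * k) ≡ ∑ xs f * k
  ∑-*ʳ xs f k = trans (∑-cong xs (λ x → *-comm (f x) k)) (trans (∑-*ˡ xs k f) (*-comm k _))

  ∑-swap : ∀ (xs : List A) (ys : List A′) (f : A → A′ → ℕ) →
           ∑ xs (λ x → ∑ ys (f x)) ≡ ∑ ys (λ y → ∑ xs (λ x → f x y))
  ∑-swap []       ys f = sym (∑-0 ys (λ _ → refl))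
  ∑-swap (x ∷ xs) ys f rewrite ∑-swap xs ys f = sym (∑-+ ys (f x) (λ y → ∑ xs (λ x → f x y)))

  ∑-++ : ∀ (xs ys : List A) (f : A → ℕ) → ∑ (xs ++ ys) f ≡ ∑ xs f + ∑ ys f
  ∑-++ []       ys f = refl
  ∑-++ (x ∷ xs) ys f rewrite ∑-++ xs ys f = sym (+-assoc (f x) _ _)

  ∑-map : ∀ (h : A → A′) (xs : List A) (f : A′ → ℕ) → ∑ (List.map h xs) f ≡ ∑ xs (f ∘ h)
  ∑-map h []       f = refl
  ∑-map h (x ∷ xs) f = cong (f (h x) +_) (∑-map h xs f)

  ∑-concatMap : ∀ (h : A → List A′) (xs : List A) (f : A′ → ℕ) →
                ∑ (concatMap h xs) f ≡ ∑ xs (λ x → ∑ (h x) f)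
  ∑-concatMap h []       f = refl
  ∑-concatMap h (x ∷ xs) f = trans (∑-++ (h x) (concatMap h xs) f) (cong (∑ (h x) f +_) (∑-concatMap h xs f))

  length-filter : ∀ {P : Pred A 0ℓ} (P? : Decidable P) (xs : List A) →
                  length (filter P? xs) ≡ ∑ xs (λ x → ⟦ P? x ⟧)
  length-filter P? [] = refl
  length-filter P? (x ∷ xs) with does (P? x)
  ... | true  = cong suc (length-filter P? xs)
  ... | false = length-filter P? xs

  ∑-allFin : ∀ k (f : Fin (suc k) → ℕ) → ∑ (allFin (suc k)) f ≡ f zero + ∑ (allFin k) (f ∘ suc)
  ∑-allFin k f = cong (f zero +_) (tab id)
    where
    tab : ∀ {j} (h : Fin j → Fin k) → ∑ (tabulate (λ x → suc (h x))) f ≡ ∑ (tabulate h) (f ∘ suc)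
    tab {zero}  h = refl
    tab {suc j} h = cong (f (suc (h zero)) +_) (tab (h ∘ suc))

  ∑-one : ∀ k → ∑ (allFin k) (λ _ → 1) ≡ k
  ∑-one zero    = refl
  ∑-one (suc k) = trans (∑-allFin k (λ _ → 1)) (cong suc (∑-one k))

  ∑-δ : ∀ {k} (c : Fin k) (f : Fin k → ℕ) → ∑ (allFin k) (λ x → ⟦ c ≟ x ⟧ * f x) ≡ f c
  ∑-δ {suc k} zero f = trans (∑-allFin k (λ x → ⟦ zero ≟ x ⟧ * f x))
    (trans (cong₂ _+_ (+-identityʳ (f zero)) (∑-0 (allFin k) (λ _ → refl))) (+-identityʳ (f zero)))
  ∑-δ {suc k} (suc c) f = trans (∑-allFin k (λ x → ⟦ suc c ≟ x ⟧ * f x))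
    (trans (∑-cong (allFin k) (λ x → cong (_* f (suc x)) (⟦⟧-cong (suc c ≟ suc x) (c ≟ x) suc-injective (cong suc))))
           (∑-δ c (f ∘ suc)))

  _≟ᶜ_ : ∀ {m q} → DecidableEquality (Coloring m q)
  _≟ᶜ_ = ≡-dec _≟_

  ∑ᶜ : ∀ {m q} → (Coloring m q → ℕ) → ℕ
  ∑ᶜ {m} {q} = ∑ (allColorings m q)

  ∑ᶜ-∷ : ∀ {m q} (f : Coloring (suc m) q → ℕ) → ∑ᶜ f ≡ ∑ᶜ (λ σ → ∑ (allFin q) (λ c → f (c ∷ σ)))
  ∑ᶜ-∷ {m} {q} f = trans (∑-concatMap _ (allColorings m q) f)
    (∑-cong (allColorings m q) (λ σ → ∑-map (_∷ σ) (allFin q) f))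

  -- In other words, `allColorings` lists every colouring exactly once; the transport theory below
  -- asks nothing else of that list.
  ∑ᶜ-δ : ∀ {m q} (σ : Coloring m q) (f : Coloring m q → ℕ) → ∑ᶜ (λ τ → ⟦ σ ≟ᶜ τ ⟧ * f τ) ≡ f σ
  ∑ᶜ-δ {zero} [] f = trans (+-identityʳ _) (+-identityʳ _)
  ∑ᶜ-δ {suc m} {q} (c ∷ σ) f = trans (∑ᶜ-∷ (λ τ → ⟦ (c ∷ σ) ≟ᶜ τ ⟧ * f τ))
    (trans (∑-cong (allColorings m q) inner) (∑ᶜ-δ σ (λ τ → f (c ∷ τ))))
    where
    split : ∀ τ x → ⟦ (c ∷ σ) ≟ᶜ (x ∷ τ) ⟧ ≡ ⟦ σ ≟ᶜ τ ⟧ * ⟦ c ≟ x ⟧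
    split τ x = trans (⟦⟧-cong ((c ∷ σ) ≟ᶜ (x ∷ τ)) ((σ ≟ᶜ τ) ×-dec (c ≟ x))
                         (λ e → proj₂ (∷-injective e) , proj₁ (∷-injective e))
                         (λ (e , e′) → cong₂ _∷_ e′ e))
                      (⟦⟧-* (σ ≟ᶜ τ) (c ≟ x))
    inner : ∀ τ → ∑ (allFin q) (λ x → ⟦ (c ∷ σ) ≟ᶜ (x ∷ τ) ⟧ * f (x ∷ τ)) ≡ ⟦ σ ≟ᶜ τ ⟧ * f (c ∷ τ)
    inner τ = trans (∑-cong (allFin q) (λ x → trans (cong (_* f (x ∷ τ)) (split τ x)) (*-assoc ⟦ σ ≟ᶜ τ ⟧ ⟦ c ≟ x ⟧ _)))
      (trans (∑-*ˡ (allFin q) ⟦ σ ≟ᶜ τ ⟧ (λ x → ⟦ c ≟ x ⟧ * f (x ∷ τ)))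
             (cong (⟦ σ ≟ᶜ τ ⟧ *_) (∑-δ c (λ x → f (x ∷ τ)))))

  -- A colouring arises as `σ [ j ]≔ c` from exactly `q` pairs: `c` must be its colour at `j`, while
  -- the overwritten colour of `σ` is arbitrary. Two sets of colourings can thus be compared
  -- separately on each family of colourings that differ only at `j`.
  ∑ᶜ-recolor : ∀ {m q} (j : Fin m) (f : Coloring m q → ℕ) →
               ∑ᶜ (λ σ → ∑ (allFin q) (λ c → f (σ [ j ]≔ c))) ≡ q * ∑ᶜ f
  ∑ᶜ-recolor {suc m} {q} zero f =
    trans (∑ᶜ-∷ (λ σ → ∑ (allFin q) (λ c → f (σ [ zero ]≔ c))))
    (trans (∑-cong (allColorings m q) (λ σ →
       trans (∑-*ʳ-const (∑ (allFin q) (λ c → f (c ∷ σ)))) refl))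
    (trans (∑-*ˡ (allColorings m q) q (λ σ → ∑ (allFin q) (λ c → f (c ∷ σ))))
           (cong (q *_) (sym (∑ᶜ-∷ f)))))
    where
    ∑-*ʳ-const : ∀ k → ∑ (allFin q) (λ _ → k) ≡ q * k
    ∑-*ʳ-const k = trans (∑-cong (allFin q) (λ _ → sym (*-identityˡ k)))
      (trans (∑-*ʳ (allFin q) (λ _ → 1) k) (cong (_* k) (∑-one q)))
  ∑ᶜ-recolor {suc m} {q} (suc j) f =
    trans (∑ᶜ-∷ (λ σ → ∑ (allFin q) (λ c → f (σ [ suc j ]≔ c))))
    (trans (∑-swap (allColorings m q) (allFin q) (λ σ x → ∑ (allFin q) (λ c → f (x ∷ (σ [ j ]≔ c)))))
    (trans (∑-cong (allFin q) (λ x → ∑ᶜ-recolor j (λ σ → f (x ∷ σ))))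
    (trans (∑-*ˡ (allFin q) q (λ x → ∑ᶜ (λ σ → f (x ∷ σ))))
    (cong (q *_) (trans (∑-swap (allFin q) (allColorings m q) (λ x σ → f (x ∷ σ))) (sym (∑ᶜ-∷ f)))))))

  ∣∣-∑ : ∀ {k} (S : Subset k) → ∣ S ∣ ≡ ∑ (allFin k) (λ c → ⟦ c ∈? S ⟧)
  ∣∣-∑ [] = refl
  ∣∣-∑ {suc k} (inside ∷ S) = trans (cong suc (∣∣-∑ S)) (sym (trans (∑-allFin k (λ c → ⟦ c ∈? (inside ∷ S) ⟧)) (cong suc (∑-cong (allFin k) (λ _ → refl)))))
  ∣∣-∑ {suc k} (outside ∷ S) = trans (∣∣-∑ S) (sym (trans (∑-allFin k (λ c → ⟦ c ∈? (outside ∷ S) ⟧)) (∑-cong (allFin k) (λ _ → refl))))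

  module _ {k : ℕ} where
    open DecMembership (_≟_ {k}) using () renaming (_∈?_ to _∈ₗ?_)

    ∈∉? : (S : Subset k) (bs : List (Fin k)) (c : Fin k) → Dec (c ∈ S × ¬ c ∈ₗ bs)
    ∈∉? S bs c = (c ∈? S) ×-dec ¬? (c ∈ₗ? bs)

    -- Each entry of `bs` removes at most one element, whether or not it repeats or lies in `S`.
    size-minus : (S : Subset k) (bs : List (Fin k)) →
                 ∣ S ∣ ≤ ∑ (allFin k) (λ c → ⟦ ∈∉? S bs c ⟧) + length bs
    size-minus S [] = ≤-trans (≤-reflexive (∣∣-∑ S)) (≤-trans
      (∑-mono (allFin k) (λ c → ⟦⟧-mono (c ∈? S) (∈∉? S [] c) (λ h → h , λ ()))) (m≤m+n _ 0))
    size-minus S (b ∷ bs) = ≤-trans (size-minus S bs) (≤-trans (+-monoˡ-≤ (length bs) step) (≤-reflexive (+-assoc _ 1 (length bs))))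
      where
      pw : ∀ c → ⟦ ∈∉? S bs c ⟧ ≤ ⟦ ∈∉? S (b ∷ bs) c ⟧ + ⟦ b ≟ c ⟧ * 1
      pw c with b ≟ c
      ... | yes _   = ≤-trans (⟦⟧≤1 (∈∉? S bs c)) (m≤n+m 1 _)
      ... | no b≢c = ≤-trans (⟦⟧-mono (∈∉? S bs c) (∈∉? S (b ∷ bs) c)
                         (λ (p , n) → p , λ { (here e) → b≢c (sym e) ; (there r) → n r })) (m≤m+n _ _)
      step : ∑ (allFin k) (λ c → ⟦ ∈∉? S bs c ⟧) ≤ ∑ (allFin k) (λ c → ⟦ ∈∉? S (b ∷ bs) c ⟧) + 1
      step = ≤-trans (∑-mono (allFin k) pw) (≤-reflexive (trans (∑-+ (allFin k) (λ c → ⟦ ∈∉? S (b ∷ bs) c ⟧) (λ c → ⟦ b ≟ c ⟧ * 1))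
               (cong (∑ (allFin k) (λ c → ⟦ ∈∉? S (b ∷ bs) c ⟧) +_) (∑-δ b (λ _ → 1)))))

  -- Transport plans between finite measures with natural values.

  module Transport {C : Set} (xs : List C) (_≟_ : DecidableEquality C)
    (∑-δ : ∀ x (f : C → ℕ) → ∑ xs (λ y → ⟦ x ≟ y ⟧ * f y) ≡ f x)
    (d : C → C → ℕ) (d-refl : ∀ x → d x x ≡ 0) (d-sym : ∀ x y → d x y ≡ d y x)
    (d-tri : ∀ x y z → d x z ≤ d x y + d y z) where

    Measure : Set
    Measure = C → ℕ

    ∣_∣ₘ : Measure → ℕ
    ∣ μ ∣ₘ = ∑ xs μ

    planCost : (C → C → ℕ) → ℕ
    planCost ω = ∑ xs (λ x → ∑ xs (λ y → ω x y * d x y))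

    ≤∑ : ∀ (f : C → ℕ) x → f x ≤ ∑ xs f
    ≤∑ f x = ≤-trans (≤-reflexive (sym (∑-δ x f)))
      (∑-mono xs (λ y → ≤-trans (*-monoˡ-≤ (f y) (⟦⟧≤1 (x ≟ y))) (≤-reflexive (*-identityˡ (f y)))))

    ∣∣≡0⇒ : ∀ {μ} → ∣ μ ∣ₘ ≡ 0 → ∀ x → μ x ≡ 0
    ∣∣≡0⇒ {μ} e x = n≤0⇒n≡0 (≤-trans (≤∑ μ x) (≤-reflexive e))

    cost-+ : ∀ k l (ω ω′ : C → C → ℕ) →
             planCost (λ x y → k * ω x y + l * ω′ x y) ≡ k * planCost ω + l * planCost ω′
    cost-+ k l ω ω′ = trans (∑-cong xs inner)
      (trans (∑-+ xs (λ x → k * r ω x) (λ x → l * r ω′ x)) (cong₂ _+_ (∑-*ˡ xs k (r ω)) (∑-*ˡ xs l (r ω′))))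
      where
      r : (C → C → ℕ) → C → ℕ
      r ω x = ∑ xs (λ y → ω x y * d x y)
      alg : ∀ k l a b e → (k * a + l * b) * e ≡ k * (a * e) + l * (b * e)
      alg = solve-∀
      inner : ∀ x → ∑ xs (λ y → (k * ω x y + l * ω′ x y) * d x y) ≡ k * r ω x + l * r ω′ x
      inner x = trans (∑-cong xs (λ y → alg k l (ω x y) (ω′ x y) (d x y)))
        (trans (∑-+ xs (λ y → k * (ω x y * d x y)) (λ y → l * (ω′ x y * d x y)))
               (cong₂ _+_ (∑-*ˡ xs k _) (∑-*ˡ xs l _)))

    -- A transport plan of cost c, up to a common integer factor n that stands in for rational weights.
    record T (μ ν : Measure) (c : ℕ) : Set where
      field
        n      : ℕ
        {{n≢0}} : NonZero n
        ω      : C → C → ℕ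
        row    : ∀ x → ∑ xs (ω x) ≡ n * μ x
        col    : ∀ y → ∑ xs (λ x → ω x y) ≡ n * ν y
        cost≤  : planCost ω ≤ n * c

    T-cong : ∀ {μ μ′ ν ν′ c c′} → T μ ν c → (∀ x → μ x ≡ μ′ x) → (∀ x → ν x ≡ ν′ x) → c ≤ c′ → T μ′ ν′ c′
    T-cong t e e′ l = record
      { n = n ; ω = ω
      ; row = λ x → trans (row x) (cong (n *_) (e x))
      ; col = λ x → trans (col x) (cong (n *_) (e′ x))
      ; cost≤ = ≤-trans cost≤ (*-monoʳ-≤ n l) }
      where open T t

    T-sym : ∀ {μ ν c} → T μ ν c → T ν μ c
    T-sym t = record
      { n = n ; ω = λ x y → ω y x ; row = col ; col = row
      ; cost≤ = ≤-trans (≤-reflexive (trans (∑-swap xs xs (λ x y → ω y x * d x y))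
                  (∑-cong xs (λ x → ∑-cong xs (λ y → cong (ω x y *_) (d-sym y x)))))) cost≤ }
      where open T t

    T-id : ∀ μ → T μ μ 0
    T-id μ = record
      { n = 1 ; ω = λ x y → ⟦ x ≟ y ⟧ * μ y
      ; row = λ x → trans (∑-δ x μ) (sym (*-identityˡ (μ x)))
      ; col = λ y → trans (∑-cong xs (λ x → flip x y)) (trans (∑-δ y (λ _ → μ y)) (sym (*-identityˡ (μ y))))
      ; cost≤ = ≤-reflexive (∑-0 xs (λ x → ∑-0 xs (λ y → zero-cost x y))) }
      where
      flip : ∀ x y → ⟦ x ≟ y ⟧ * μ y ≡ ⟦ y ≟ x ⟧ * μ y
      flip x y = cong (_* μ y) (⟦⟧-cong (x ≟ y) (y ≟ x) sym sym)
      zero-cost : ∀ x y → ⟦ x ≟ y ⟧ * μ y * d x y ≡ 0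
      zero-cost x y with x ≟ y
      ... | yes refl = trans (cong (1 * μ y *_) (d-refl y)) (*-zeroʳ (1 * μ y))
      ... | no _     = refl

    T-+ : ∀ {μ μ′ ν ν′ c c′} → T μ ν c → T μ′ ν′ c′ → T (λ x → μ x + μ′ x) (λ x → ν x + ν′ x) (c + c′)
    T-+ {μ} {μ′} {ν} {ν′} {c} {c′} t t′ = record
      { n = t.n * t′.n
      ; n≢0 = m*n≢0 t.n t′.n
      ; ω = λ x y → t′.n * t.ω x y + t.n * t′.ω x y
      ; row = λ x → trans (lin (t.ω x) (t′.ω x)) (trans (cong₂ (λ a b → t′.n * a + t.n * b) (t.row x) (t′.row x))
                                                        (alg t.n t′.n (μ x) (μ′ x)))
      ; col = λ y → trans (lin (λ x → t.ω x y) (λ x → t′.ω x y))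
                      (trans (cong₂ (λ a b → t′.n * a + t.n * b) (t.col y) (t′.col y)) (alg t.n t′.n (ν y) (ν′ y)))
      ; cost≤ = ≤-trans (≤-reflexive (cost-+ t′.n t.n t.ω t′.ω))
          (≤-trans (+-mono-≤ (*-monoʳ-≤ t′.n t.cost≤) (*-monoʳ-≤ t.n t′.cost≤)) (≤-reflexive (alg t.n t′.n c c′))) }
      where
      module t = T t
      module t′ = T t′
      lin : ∀ (f g : C → ℕ) → ∑ xs (λ y → t′.n * f y + t.n * g y) ≡ t′.n * ∑ xs f + t.n * ∑ xs g
      lin f g = trans (∑-+ xs (λ y → t′.n * f y) (λ y → t.n * g y)) (cong₂ _+_ (∑-*ˡ xs t′.n f) (∑-*ˡ xs t.n g))
      alg : ∀ n n′ a b → n′ * (n * a) + n * (n′ * b) ≡ n * n′ * (a + b)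
      alg = solve-∀

    T-0 : T (λ _ → 0) (λ _ → 0) 0
    T-0 = T-id (λ _ → 0)

    T-* : ∀ k {μ ν c} → T μ ν c → T (λ x → k * μ x) (λ x → k * ν x) (k * c)
    T-* zero    t = T-0
    T-* (suc k) t = T-+ t (T-* k t)

    -- Division without fractions: the factor `k` is moved into the common factor `n` of the plan.
    T-cancel : ∀ k {{_ : NonZero k}} {μ ν c} → T (λ x → k * μ x) (λ x → k * ν x) (k * c) → T μ ν c
    T-cancel k {μ} {ν} {c} t = record
      { n = n * k ; n≢0 = m*n≢0 n k ; ω = ω
      ; row = λ x → trans (row x) (sym (*-assoc n k (μ x)))
      ; col = λ x → trans (col x) (sym (*-assoc n k (ν x)))
      ; cost≤ = ≤-trans cost≤ (≤-reflexive (sym (*-assoc n k c))) }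
      where open T t

    T-∑ : ∀ {I : Set} (js : List I) {μ ν : I → Measure} {c : I → ℕ} → (∀ j → T (μ j) (ν j) (c j)) →
          T (λ x → ∑ js (λ j → μ j x)) (λ x → ∑ js (λ j → ν j x)) (∑ js c)
    T-∑ []       t = T-0
    T-∑ (j ∷ js) t = T-+ (t j) (T-∑ js t)

    -- W₁(μ/∣μ∣, ν/∣ν∣) ≤ K with denominators cleared; it holds trivially if one of the masses is 0.
    W : Measure → Measure → ℕ → Set
    W μ ν K = T (λ x → ∣ ν ∣ₘ * μ x) (λ x → ∣ μ ∣ₘ * ν x) (∣ μ ∣ₘ * ∣ ν ∣ₘ * K)

    W-sym : ∀ {μ ν K} → W μ ν K → W ν μ K
    W-sym {μ} {ν} {K} w = T-cong (T-sym w) (λ _ → refl) (λ _ → refl) (≤-reflexive (cong (_* K) (*-comm ∣ μ ∣ₘ ∣ ν ∣ₘ)))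

    W-mono : ∀ {μ ν K K′} → K ≤ K′ → W μ ν K → W μ ν K′
    W-mono {μ} {ν} l w = T-cong w (λ _ → refl) (λ _ → refl) (*-monoʳ-≤ (∣ μ ∣ₘ * ∣ ν ∣ₘ) l)

    W-cong : ∀ {μ μ′ ν ν′ K} → (∀ x → μ x ≡ μ′ x) → (∀ x → ν x ≡ ν′ x) → W μ ν K → W μ′ ν′ K
    W-cong {K = K} e e′ w = T-cong w (λ x → cong₂ _*_ (∑-cong xs e′) (e x)) (λ x → cong₂ _*_ (∑-cong xs e) (e′ x))
      (≤-reflexive (cong (_* K) (cong₂ _*_ (∑-cong xs e) (∑-cong xs e′))))

    W-zeroˡ : ∀ {μ ν K} → ∣ μ ∣ₘ ≡ 0 → W μ ν K
    W-zeroˡ {μ} {ν} {K} e = T-cong T-0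
      (λ x → sym (trans (cong (∣ ν ∣ₘ *_) (∣∣≡0⇒ e x)) (*-zeroʳ ∣ ν ∣ₘ)))
      (λ x → sym (cong (_* ν x) e)) z≤n

    W-zeroʳ : ∀ {μ ν K} → ∣ ν ∣ₘ ≡ 0 → W μ ν K
    W-zeroʳ e = W-sym (W-zeroˡ e)

    -- Convexity of the transport distance in one argument: each summand is moved onto its own
    -- proportional share of `ν`. With `W-∑ʳ`, a bound for every pair of pieces passes to the
    -- wholes, and no pairing of the pieces has to be chosen.
    W-+ˡ : ∀ {μ μ′ ν K} → W μ ν K → W μ′ ν K → W (λ x → μ x + μ′ x) ν K
    W-+ˡ {μ} {μ′} {ν} {K} w w′ = T-cong (T-+ w w′)
      (λ x → sym (*-distribˡ-+ ∣ ν ∣ₘ (μ x) (μ′ x)))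
      (λ x → trans (sym (*-distribʳ-+ (ν x) ∣ μ ∣ₘ ∣ μ′ ∣ₘ)) (cong (_* ν x) (sym (∑-+ xs μ μ′))))
      (≤-reflexive (trans (alg ∣ μ ∣ₘ ∣ μ′ ∣ₘ ∣ ν ∣ₘ K) (cong (λ s → s * ∣ ν ∣ₘ * K) (sym (∑-+ xs μ μ′)))))
      where
      alg : ∀ a b c k → a * c * k + b * c * k ≡ (a + b) * c * k
      alg = solve-∀

    W-*ˡ : ∀ k {μ ν K} → W μ ν K → W (λ x → k * μ x) ν K
    W-*ˡ k {μ} {ν} {K} w = T-cong (T-* k w)
      (λ x → swap₁ k ∣ ν ∣ₘ (μ x))
      (λ x → trans (sym (*-assoc k ∣ μ ∣ₘ (ν x))) (cong (_* ν x) (sym (∑-*ˡ xs k μ))))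
      (≤-reflexive (trans (alg k ∣ μ ∣ₘ ∣ ν ∣ₘ K) (cong (λ s → s * ∣ ν ∣ₘ * K) (sym (∑-*ˡ xs k μ)))))
      where
      swap₁ : ∀ k a b → k * (a * b) ≡ a * (k * b)
      swap₁ = solve-∀
      alg : ∀ k a c K → k * (a * c * K) ≡ k * a * c * K
      alg = solve-∀

    W-∑ˡ : ∀ {I : Set} (js : List I) {μ : I → Measure} {ν K} → (∀ j → W (μ j) ν K) → W (λ x → ∑ js (λ j → μ j x)) ν K
    W-∑ˡ []       {ν = ν} w = W-zeroˡ {ν = ν} (∑-0 xs (λ _ → refl))
    W-∑ˡ (j ∷ js) {ν = ν} w = W-+ˡ {ν = ν} (w j) (W-∑ˡ js {ν = ν} w)

    W-∑ʳ : ∀ {I : Set} (js : List I) {ν : I → Measure} {μ K} → (∀ j → W μ (ν j) K) → W μ (λ x → ∑ js (λ j → ν j x)) K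
    W-∑ʳ js {ν} {μ} w = W-sym {ν = μ} (W-∑ˡ js {μ = ν} {ν = μ} (λ j → W-sym {μ = μ} {ν = ν j} (w j)))

    -- Gluing along a 0/1-valued middle measure needs no division.
    W-trans : ∀ {μ κ ν K L} {{_ : NonZero ∣ κ ∣ₘ}} → (∀ y → κ y * κ y ≡ κ y) →
              W μ κ K → W κ ν L → W μ ν (K + L)
    W-trans {μ} {κ} {ν} {K} {L} idem s t = T-cancel ∣ κ ∣ₘ glued
      where
      module s = T s
      module t = T t
      a b c : ℕ
      a = ∣ μ ∣ₘ
      b = ∣ κ ∣ₘ
      c = ∣ ν ∣ₘ
      -- Where `κ` is 0, the whole column (or row) of the plan vanishes; where it is 1, the factor
      -- changes nothing.
      absorb : ∀ k (f : C → ℕ) y → ∑ xs f ≡ k * κ y → ∀ x → f x * κ y ≡ f x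
      absorb k f y e x with κ y | idem y
      ... | zero        | _ = trans (*-zeroʳ (f x)) (sym (n≤0⇒n≡0 (≤-trans (≤∑ f x) (≤-reflexive (trans e (*-zeroʳ k))))))
      ... | suc zero    | _ = *-identityʳ (f x)
      ... | suc (suc j) | e′ with *-cancelʳ-≡ (suc (suc j)) 1 (suc (suc j)) (trans e′ (sym (*-identityˡ _)))
      ...   | ()
      absorb₁ : ∀ x y → s.ω x y * κ y ≡ s.ω x y
      absorb₁ x y = absorb (s.n * a) (λ x → s.ω x y) y (trans (s.col y) (sym (*-assoc s.n a (κ y)))) x
      absorb₂ : ∀ y z → t.ω y z * κ y ≡ t.ω y z
      absorb₂ y z = absorb (t.n * c) (t.ω y) y (trans (t.row y) (sym (*-assoc t.n c (κ y)))) z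

      ω : C → C → ℕ
      ω x z = ∑ xs (λ y → s.ω x y * t.ω y z)

      outflow : ∀ x y → s.ω x y * ∑ xs (t.ω y) ≡ t.n * c * s.ω x y
      outflow x y = trans (cong (s.ω x y *_) (t.row y))
        (trans (alg (s.ω x y) t.n c (κ y)) (cong (t.n * c *_) (absorb₁ x y)))
        where
        alg : ∀ w n c k → w * (n * (c * k)) ≡ n * c * (w * k)
        alg = solve-∀
      inflow : ∀ y z → ∑ xs (λ x → s.ω x y) * t.ω y z ≡ s.n * a * t.ω y z
      inflow y z = trans (cong (_* t.ω y z) (s.col y))
        (trans (alg (t.ω y z) s.n a (κ y)) (cong (s.n * a *_) (absorb₂ y z)))
        where
        alg : ∀ w n c k → n * (c * k) * w ≡ n * c * (w * k)
        alg = solve-∀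

      row : ∀ x → ∑ xs (ω x) ≡ s.n * t.n * (b * (c * μ x))
      row x = trans (∑-swap xs xs (λ z y → s.ω x y * t.ω y z))
        (trans (∑-cong xs (λ y → trans (∑-*ˡ xs (s.ω x y) (t.ω y)) (outflow x y)))
        (trans (∑-*ˡ xs (t.n * c) (s.ω x))
        (trans (cong (t.n * c *_) (s.row x)) (alg s.n t.n b c (μ x)))))
        where
        alg : ∀ n n′ b c m → n′ * c * (n * (b * m)) ≡ n * n′ * (b * (c * m))
        alg = solve-∀
      col : ∀ z → ∑ xs (λ x → ω x z) ≡ s.n * t.n * (b * (a * ν z))
      col z = trans (∑-swap xs xs (λ x y → s.ω x y * t.ω y z))
        (trans (∑-cong xs (λ y → trans (∑-*ʳ xs (λ x → s.ω x y) (t.ω y z)) (inflow y z)))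
        (trans (∑-*ˡ xs (s.n * a) (λ y → t.ω y z))
        (trans (cong (s.n * a *_) (t.col z)) (alg s.n t.n b a (ν z)))))
        where
        alg : ∀ n n′ b a m → n * a * (n′ * (b * m)) ≡ n * n′ * (b * (a * m))
        alg = solve-∀

      cost-bound : planCost ω ≤ t.n * c * planCost s.ω + s.n * a * planCost t.ω
      cost-bound = begin
        ∑ xs (λ x → ∑ xs (λ z → ω x z * d x z))
          ≡⟨ ∑-cong xs (λ x → trans (∑-cong xs (λ z → sym (∑-*ʳ xs (λ y → s.ω x y * t.ω y z) (d x z))))
                                    (∑-swap xs xs (λ z y → s.ω x y * t.ω y z * d x z))) ⟩
        ∑ xs (λ x → ∑ xs (λ y → ∑ xs (λ z → s.ω x y * t.ω y z * d x z)))
          ≤⟨ ∑-mono xs (λ x → ∑-mono xs (λ y → ∑-mono xs (λ z → *-monoʳ-≤ (s.ω x y * t.ω y z) (d-tri x y z)))) ⟩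
        ∑ xs (λ x → ∑ xs (λ y → ∑ xs (λ z → s.ω x y * t.ω y z * (d x y + d y z))))
          ≡⟨ ∑-cong xs (λ x → ∑-cong xs (λ y → trans
               (∑-cong xs (λ z → alg (s.ω x y) (t.ω y z) (d x y) (d y z)))
               (trans (∑-+ xs (λ z → s.ω x y * d x y * t.ω y z) (λ z → s.ω x y * (t.ω y z * d y z)))
                      (cong₂ _+_ (trans (∑-*ˡ xs (s.ω x y * d x y) (t.ω y)) (first x y))
                                 (∑-*ˡ xs (s.ω x y) (λ z → t.ω y z * d y z)))))) ⟩
        ∑ xs (λ x → ∑ xs (λ y → t.n * c * (s.ω x y * d x y) + s.ω x y * D y))
          ≡⟨ trans (∑-cong xs (λ x → trans (∑-+ xs (λ y → t.n * c * (s.ω x y * d x y)) (λ y → s.ω x y * D y))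
                                           (cong (_+ ∑ xs (λ y → s.ω x y * D y)) (∑-*ˡ xs (t.n * c) (λ y → s.ω x y * d x y)))))
                   (trans (∑-+ xs (λ x → t.n * c * ∑ xs (λ y → s.ω x y * d x y)) (λ x → ∑ xs (λ y → s.ω x y * D y)))
                          (cong₂ _+_ (∑-*ˡ xs (t.n * c) (λ x → ∑ xs (λ y → s.ω x y * d x y))) second)) ⟩
        t.n * c * planCost s.ω + s.n * a * planCost t.ω ∎
        where
        open ≤-Reasoning
        D : C → ℕ
        D y = ∑ xs (λ z → t.ω y z * d y z)
        alg : ∀ p q e f → p * q * (e + f) ≡ p * e * q + p * (q * f)
        alg = solve-∀
        first : ∀ x y → s.ω x y * d x y * ∑ xs (t.ω y) ≡ t.n * c * (s.ω x y * d x y)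
        first x y = trans (comm₁ (s.ω x y) (d x y) (∑ xs (t.ω y)))
          (trans (cong (_* d x y) (outflow x y)) (*-assoc (t.n * c) (s.ω x y) (d x y)))
          where
          comm₁ : ∀ p q r → p * q * r ≡ p * r * q
          comm₁ = solve-∀
        D-absorb : ∀ y → ∑ xs (λ x → s.ω x y) * D y ≡ s.n * a * D y
        D-absorb y = trans (sym (∑-*ˡ xs (∑ xs (λ x → s.ω x y)) (λ z → t.ω y z * d y z)))
          (trans (∑-cong xs (λ z → trans (sym (*-assoc (∑ xs (λ x → s.ω x y)) (t.ω y z) (d y z)))
                   (trans (cong (_* d y z) (inflow y z)) (*-assoc (s.n * a) (t.ω y z) (d y z)))))
                 (∑-*ˡ xs (s.n * a) (λ z → t.ω y z * d y z)))
        second : ∑ xs (λ x → ∑ xs (λ y → s.ω x y * D y)) ≡ s.n * a * planCost t.ω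
        second = trans (∑-swap xs xs (λ x y → s.ω x y * D y))
          (trans (∑-cong xs (λ y → trans (∑-*ʳ xs (λ x → s.ω x y) (D y)) (D-absorb y)))
                 (∑-*ˡ xs (s.n * a) D))

      glued : T (λ x → b * (c * μ x)) (λ z → b * (a * ν z)) (b * (a * c * (K + L)))
      glued = record
        { n = s.n * t.n ; n≢0 = m*n≢0 s.n t.n ; ω = ω ; row = row ; col = col
        ; cost≤ = ≤-trans cost-bound
            (≤-trans (+-mono-≤ (*-monoʳ-≤ (t.n * c) s.cost≤) (*-monoʳ-≤ (s.n * a) t.cost≤))
                     (≤-reflexive (alg s.n t.n a b c K L))) }
        where
        alg : ∀ n n′ a b c K L → n′ * c * (n * (a * b * K)) + n * a * (n′ * (b * c * L)) ≡ n * n′ * (b * (a * c * (K + L)))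
        alg = solve-∀

    -- Matching two partitioned measures that share a common part.

    ∣∑∣ : ∀ {I : Set} (js : List I) (k : I → ℕ) (μ : I → Measure) →
          ∣ (λ x → ∑ js (λ j → k j * μ j x)) ∣ₘ ≡ ∑ js (λ j → k j * ∣ μ j ∣ₘ)
    ∣∑∣ js k μ = trans (∑-swap xs js (λ x j → k j * μ j x)) (∑-cong js (λ j → ∑-*ˡ xs (k j) (μ j)))

    -- Scaled by ∣μ∣, the distribution of ν is ∣ν∣ times itself plus ∣μ∣ - ∣ν∣ times itself. The first part is
    -- matched to Z, then A j to B j as far as the product β ∣B j∣ ∣A j∣ / ∣Z∣ (at most ∣A j∣ and ∣B j∣, but simpler
    -- than their minimum), then the rest of A to the rest of B; what remains of B goes to the second part.
    module Matching {I : Set} (js : List I) (Z : Measure) (B A : I → Measure)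
      (β F v Δ : ℕ) (g : I → ℕ) {{_ : NonZero ∣ Z ∣ₘ}} {{_ : NonZero β}} where

      μ ν : Measure
      μ x = Z x + ∑ js (λ j → B j x)
      ν x = Z x + ∑ js (λ j → A j x)

      private
        z Xs Ys D Nμ Nν m rb ra : ℕ
        X Y p s : I → ℕ
        z   = ∣ Z ∣ₘ
        X j = ∣ B j ∣ₘ
        Y j = ∣ A j ∣ₘ
        Xs  = ∑ js X
        Ys  = ∑ js Y
        D   = Xs ∸ Ys
        Nμ  = ∣ μ ∣ₘ
        Nν  = ∣ ν ∣ₘ
        p j = z ∸ β * Y j
        s j = z ∸ β * X j
        m   = β * ∑ js (λ j → X j * Y j)
        RB RA : Measure
        RB x = ∑ js (λ j → p j * B j x)
        RA x = ∑ js (λ j → s j * A j x)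
        rb = ∣ RB ∣ₘ
        ra = ∣ RA ∣ₘ

        total : ∀ (M : I → Measure) → ∣ (λ x → Z x + ∑ js (λ j → M j x)) ∣ₘ ≡ z + ∑ js (λ j → ∣ M j ∣ₘ)
        total M = trans (∑-+ xs Z (λ x → ∑ js (λ j → M j x))) (cong (z +_) (∑-swap xs js (λ x j → M j x)))

      module _ (capB : ∀ j → β * ∣ B j ∣ₘ ≤ ∣ Z ∣ₘ) (capA : ∀ j → β * ∣ A j ∣ₘ ≤ ∣ Z ∣ₘ)
        (caps : ∀ j → ∣ Z ∣ₘ * (β * ∣ B j ∣ₘ + β * ∣ A j ∣ₘ) ≤ g j * (∣ Z ∣ₘ * ∣ Z ∣ₘ) + β * ∣ B j ∣ₘ * (β * ∣ A j ∣ₘ))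
        (∑g≤Δ : ∑ js g ≤ Δ) (Δ≤ : Δ * (v + F) ≤ β * F)
        (A≤B : ∑ js (λ j → ∣ A j ∣ₘ) ≤ ∑ js (λ j → ∣ B j ∣ₘ))
        (same  : ∀ j → W (B j) (A j) (v + F))
        (cross : ∀ j l → W (B j) (A l) (2 * v + 3 * F))
        (onto  : ∀ j → W (B j) ν (v + 2 * F)) where

        private
          split : ∀ (k M : I → ℕ) (f : I → ℕ) → (∀ j → k j + β * M j ≡ z) →
                  ∑ js (λ j → k j * f j) + β * ∑ js (λ j → M j * f j) ≡ z * ∑ js f
          split k M f e = trans (cong (∑ js (λ j → k j * f j) +_) (sym (∑-*ˡ js β (λ j → M j * f j))))
            (trans (sym (∑-+ js (λ j → k j * f j) (λ j → β * (M j * f j))))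
            (trans (∑-cong js (λ j → trans (alg (k j) β (M j) (f j)) (cong (_* f j) (e j)))) (∑-*ˡ js z f)))
            where
            alg : ∀ k b M f → k * f + b * (M * f) ≡ (k + b * M) * f
            alg = solve-∀

          rb+m : rb + m ≡ z * Xs
          rb+m = trans (cong₂ _+_ (∣∑∣ js p B) (cong (β *_) (∑-cong js (λ j → *-comm (X j) (Y j)))))
                       (split p Y X (λ j → m∸n+n≡m (capA j)))

          ra+m : ra + m ≡ z * Ys
          ra+m = trans (cong (_+ m) (∣∑∣ js s A)) (split s X Y (λ j → m∸n+n≡m (capB j)))

          Xs≡ : Xs ≡ Ys + D
          Xs≡ = sym (m+[n∸m]≡n A≤B)

          rb≡ : rb ≡ ra + z * D
          rb≡ = +-cancelʳ-≡ m rb (ra + z * D) (begin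
            rb + m         ≡⟨ rb+m ⟩
            z * Xs         ≡⟨ cong (z *_) Xs≡ ⟩
            z * (Ys + D)   ≡⟨ *-distribˡ-+ z Ys D ⟩
            z * Ys + z * D ≡⟨ cong (_+ z * D) (sym ra+m) ⟩
            ra + m + z * D ≡⟨ alg ra m (z * D) ⟩
            ra + z * D + m ∎)
            where
            open ≡-Reasoning
            alg : ∀ a b c → a + b + c ≡ a + c + b
            alg = solve-∀

          Nμ≡ : Nμ ≡ Nν + D
          Nμ≡ = trans (total B) (trans (cong (z +_) Xs≡) (trans (sym (+-assoc z Ys D)) (cong (_+ D) (sym (total A)))))

          e : ℕ
          e = rb + ra + m

          -- For each `j`, β times its share of `e` is z (β X j + β Y j) - β X j · β Y j, which
          -- `caps` bounds by `g j` z². The term `β * m` is added on both sides to avoid the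
          -- subtraction.
          βe≤ : β * e ≤ Δ * (z * z)
          βe≤ = +-cancelʳ-≤ (β * m) (β * e) (Δ * (z * z)) (begin
            β * e + β * m                  ≡⟨ alg₁ β rb ra m ⟩
            β * ((rb + m) + (ra + m))      ≡⟨ cong (β *_) (cong₂ _+_ rb+m ra+m) ⟩
            β * (z * Xs + z * Ys)          ≡⟨ alg₂ β z Xs Ys ⟩
            z * (β * Xs + β * Ys)          ≡⟨ cong (z *_) (sym (cong₂ _+_ (∑-*ˡ js β X) (∑-*ˡ js β Y))) ⟩
            z * (∑ js (λ j → β * X j) + ∑ js (λ j → β * Y j)) ≡⟨ cong (z *_) (sym (∑-+ js _ _)) ⟩
            z * ∑ js (λ j → β * X j + β * Y j) ≡⟨ sym (∑-*ˡ js z _) ⟩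
            ∑ js (λ j → z * (β * X j + β * Y j)) ≤⟨ ∑-mono js caps ⟩
            ∑ js (λ j → g j * (z * z) + β * X j * (β * Y j)) ≡⟨ ∑-+ js _ _ ⟩
            ∑ js (λ j → g j * (z * z)) + ∑ js (λ j → β * X j * (β * Y j))
              ≡⟨ cong₂ _+_ (∑-*ʳ js g (z * z)) (trans (∑-cong js (λ j → alg₃ β (X j) (Y j)))
                   (trans (∑-*ˡ js (β * β) _) (*-assoc β β _))) ⟩
            ∑ js g * (z * z) + β * m       ≤⟨ +-monoˡ-≤ (β * m) (*-monoˡ-≤ (z * z) ∑g≤Δ) ⟩
            Δ * (z * z) + β * m            ∎)
            where
            open ≤-Reasoning
            alg₁ : ∀ b r a m → b * (r + a + m) + b * m ≡ b * ((r + m) + (a + m))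
            alg₁ = solve-∀
            alg₂ : ∀ b z x y → b * (z * x + z * y) ≡ z * (b * x + b * y)
            alg₂ = solve-∀
            alg₃ : ∀ b x y → b * x * (b * y) ≡ b * b * (x * y)
            alg₃ = solve-∀

          e≤ : e * (v + F) ≤ z * z * F
          e≤ = *-cancelˡ-≤ β (begin
            β * (e * (v + F))       ≡⟨ sym (*-assoc β e (v + F)) ⟩
            β * e * (v + F)         ≤⟨ *-monoˡ-≤ (v + F) βe≤ ⟩
            Δ * (z * z) * (v + F)   ≡⟨ alg₁ Δ (z * z) (v + F) ⟩
            z * z * (Δ * (v + F))   ≤⟨ *-monoʳ-≤ (z * z) Δ≤ ⟩
            z * z * (β * F)         ≡⟨ alg₂ (z * z) β F ⟩
            β * (z * z * F)         ∎)
            where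
            open ≤-Reasoning
            alg₁ : ∀ a b c → a * b * c ≡ b * (a * c)
            alg₁ = solve-∀
            alg₂ : ∀ a b c → a * (b * c) ≡ b * (a * c)
            alg₂ = solve-∀

          -- Every unit of `rb`, `ra` and `m` pays v + F, and every unit of `rb` and `m` pays a
          -- further F: since `rb` is `ra + z * D`, this is 2v + 3F on `ra` and v + 2F on `z * D`.
          -- The first kind of payment is at most z² F by `e≤`, the second is z Xs F by `rb+m`, and
          -- z (z + Xs) is z Nμ. The extra `m * F` added at the start is slack.
          budget : m * (v + F) + (ra * (2 * v + 3 * F) + z * D * (v + 2 * F)) ≤ z * Nμ * F
          budget = begin
            m * (v + F) + (ra * (2 * v + 3 * F) + z * D * (v + 2 * F))
              ≤⟨ m≤m+n _ (m * F) ⟩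
            m * (v + F) + (ra * (2 * v + 3 * F) + z * D * (v + 2 * F)) + m * F
              ≡⟨ alg₁ m ra (z * D) v F ⟩
            ((ra + z * D) + ra + m) * (v + F) + ((ra + z * D) + m) * F
              ≡⟨ cong (λ r → (r + ra + m) * (v + F) + (r + m) * F) (sym rb≡) ⟩
            e * (v + F) + (rb + m) * F ≤⟨ +-monoˡ-≤ ((rb + m) * F) e≤ ⟩
            z * z * F + (rb + m) * F   ≡⟨ cong (λ t → z * z * F + t * F) rb+m ⟩
            z * z * F + z * Xs * F     ≡⟨ alg₂ z F Xs ⟩
            z * (z + Xs) * F           ≡⟨ cong (λ t → z * t * F) (sym (total B)) ⟩
            z * Nμ * F                 ∎
            where
            open ≤-Reasoning
            alg₁ : ∀ m a d v F → m * (v + F) + (a * (2 * v + 3 * F) + d * (v + 2 * F)) + m * F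
                   ≡ ((a + d) + a + m) * (v + F) + ((a + d) + m) * F
            alg₁ = solve-∀
            alg₂ : ∀ z F x → z * z * F + z * x * F ≡ z * (z + x) * F
            alg₂ = solve-∀

          same-part : T (λ x → ∑ js (λ j → Y j * B j x)) (λ x → ∑ js (λ j → X j * A j x))
                        (∑ js (λ j → X j * Y j * (v + F)))
          same-part = T-∑ js same

          cross-part : W RB RA (2 * v + 3 * F)
          cross-part = W-∑ˡ js {ν = RA} (λ j → W-*ˡ (p j) {ν = RA}
            (W-∑ʳ js (λ l → W-sym {ν = B j} (W-*ˡ (s l) {ν = B j} (W-sym {μ = B j} (cross j l))))))

          onto-part : W RB ν (v + 2 * F)
          onto-part = W-∑ˡ js {ν = ν} (λ j → W-*ˡ (p j) {ν = ν} (onto j))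

          c₂ : ℕ
          c₂ = Nν * (ra * (2 * v + 3 * F) + z * D * (v + 2 * F))

          rest : T (λ x → Nν * RB x) (λ x → Nν * RA x + z * D * ν x) c₂
          rest with rb in rb-eq
          -- No remainder of B: then `ra` and `z * D` vanish too, and both measures are 0.
          ... | zero = T-cong T-0
                  (λ x → sym (trans (cong (Nν *_) (∣∣≡0⇒ rb-eq x)) (*-zeroʳ Nν)))
                  (λ x → sym (cong₂ _+_ (trans (cong (Nν *_) (∣∣≡0⇒ (m+n≡0⇒m≡0 ra ra+zD≡0) x)) (*-zeroʳ Nν))
                                        (cong (_* ν x) (m+n≡0⇒n≡0 ra ra+zD≡0))))
                  z≤n
            where
            ra+zD≡0 : ra + z * D ≡ 0
            ra+zD≡0 = trans (sym rb≡) rb-eq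
          -- The cross plan moves ra RB to rb RA, the other one Nν RB to rb ν. With weights Nν and z
          -- D they add up to rb times the plan that is wanted, because ra + z D is rb.
          ... | suc r = T-cancel (suc r) (T-cong (T-+ (T-* Nν cross-part) (T-* (z * D) onto-part))
                  (λ x → trans (alg₁ Nν ra (z * D) (RB x)) (cong (_* (Nν * RB x)) (trans (sym rb≡) rb-eq)))
                  (λ x → trans (cong (λ t → Nν * (t * RA x) + z * D * (t * ν x)) rb-eq) (alg₂ Nν (suc r) (z * D) (RA x) (ν x)))
                  (≤-reflexive (trans (cong (λ t → Nν * (t * ra * (2 * v + 3 * F)) + z * D * (t * Nν * (v + 2 * F))) rb-eq)
                                      (alg₃ Nν (suc r) ra (z * D) (2 * v + 3 * F) (v + 2 * F)))))
            where
            alg₁ : ∀ n a d b → n * (a * b) + d * (n * b) ≡ (a + d) * (n * b)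
            alg₁ = solve-∀
            alg₂ : ∀ n r d a b → n * (r * a) + d * (r * b) ≡ r * (n * a + d * b)
            alg₂ = solve-∀
            alg₃ : ∀ n r a d k l → n * (r * a * k) + d * (r * n * l) ≡ r * (n * (a * k + d * l))
            alg₃ = solve-∀

        matching : W μ ν F
        -- The whole plan is built `z` times over, since the product weights β ∣B j∣ ∣A j∣ / ∣Z∣
        -- have denominator `z`.
        matching = T-cancel z (T-cong (T-+ (T-id (λ x → Nν * z * Z x)) (T-+ (T-* (Nν * β) same-part) rest)) first second third)
          where
          regroup : ∀ (k M : I → ℕ) (P : I → Measure) → (∀ j → k j + β * M j ≡ z) → ∀ x →
            Nν * z * Z x + (Nν * β * ∑ js (λ j → M j * P j x) + Nν * ∑ js (λ j → k j * P j x))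
            ≡ z * (Nν * (Z x + ∑ js (λ j → P j x)))
          regroup k M P h x = trans (alg₁ Nν z (Z x) β (∑ js (λ j → M j * P j x)) (∑ js (λ j → k j * P j x)))
            (trans (cong (λ t → Nν * (z * Z x + t)) (split k M (λ j → P j x) h)) (alg₂ Nν z (Z x) _))
            where
            alg₁ : ∀ n z a b s t → n * z * a + (n * b * s + n * t) ≡ n * (z * a + (t + b * s))
            alg₁ = solve-∀
            alg₂ : ∀ n z a s → n * (z * a + z * s) ≡ z * (n * (a + s))
            alg₂ = solve-∀
          first : ∀ x → Nν * z * Z x + (Nν * β * ∑ js (λ j → Y j * B j x) + Nν * RB x) ≡ z * (Nν * μ x)
          first = regroup p Y B (λ j → m∸n+n≡m (capA j))
          second : ∀ x → Nν * z * Z x + (Nν * β * ∑ js (λ j → X j * A j x) + (Nν * RA x + z * D * ν x)) ≡ z * (Nμ * ν x)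
          second x = trans (alg₁ (Nν * z * Z x) (Nν * β * ∑ js (λ j → X j * A j x)) (Nν * RA x) (z * D * ν x))
            (trans (cong (_+ z * D * ν x) (regroup s X A (λ j → m∸n+n≡m (capB j)) x))
            (trans (alg₂ z Nν D (ν x)) (cong (λ t → z * (t * ν x)) (sym Nμ≡))))
            where
            alg₁ : ∀ a b c d → a + (b + (c + d)) ≡ a + (b + c) + d
            alg₁ = solve-∀
            alg₂ : ∀ z n d y → z * (n * y) + z * d * y ≡ z * ((n + d) * y)
            alg₂ = solve-∀
          third : 0 + (Nν * β * ∑ js (λ j → X j * Y j * (v + F)) + c₂) ≤ z * (Nμ * Nν * F)
          third = begin
            Nν * β * ∑ js (λ j → X j * Y j * (v + F)) + c₂
              ≡⟨ cong (λ t → Nν * β * t + c₂) (∑-*ʳ js (λ j → X j * Y j) (v + F)) ⟩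
            Nν * β * (∑ js (λ j → X j * Y j) * (v + F)) + c₂
              ≡⟨ alg₁ Nν β _ (v + F) _ ⟩
            Nν * (m * (v + F) + (ra * (2 * v + 3 * F) + z * D * (v + 2 * F)))
              ≤⟨ *-monoʳ-≤ Nν budget ⟩
            Nν * (z * Nμ * F) ≡⟨ alg₂ Nν z Nμ F ⟩
            z * (Nμ * Nν * F) ∎
            where
            open ≤-Reasoning
            alg₁ : ∀ n b t k c → n * b * (t * k) + n * c ≡ n * (b * t * k + c)
            alg₁ = solve-∀
            alg₂ : ∀ n z m f → n * (z * m * f) ≡ z * (m * n * f)
            alg₂ = solve-∀

  ∑-witness : ∀ {A : Set} (xs : List A) (f : A → ℕ) → ∑ xs f ≡ 0 ⊎ ∃ λ x → f x ≢ 0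
  ∑-witness []       f = inj₁ refl
  ∑-witness (x ∷ xs) f with f x in e | ∑-witness xs f
  ... | suc _ | _       = inj₂ (x , λ e′ → contradiction (trans (sym e) e′) λ ())
  ... | zero  | inj₁ e′ = inj₁ e′
  ... | zero  | inj₂ w  = inj₂ w

  ⟦⟧≢0 : ∀ {A : Set} (d : Dec A) → ⟦ d ⟧ ≢ 0 → A
  ⟦⟧≢0 (yes a) _ = a
  ⟦⟧≢0 (no _)  h = contradiction refl h

  ≡0⊎NonZero : ∀ k → k ≡ 0 ⊎ NonZero k
  ≡0⊎NonZero zero    = inj₁ refl
  ≡0⊎NonZero (suc k) = inj₂ _

  upd : ∀ {k} {A : Set} → (Fin k → A) → Fin k → A → Fin k → A
  upd f j x e = if does (j ≟ e) then x else f e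

  upd-≡ : ∀ {k} {A : Set} (f : Fin k → A) j x → upd f j x j ≡ x
  upd-≡ f j x rewrite dec-true (j ≟ j) refl = refl

  upd-≢ : ∀ {k} {A : Set} (f : Fin k → A) {j} x {e} → j ≢ e → upd f j x e ≡ f e
  upd-≢ f {j} x {e} j≢e rewrite dec-false (j ≟ e) j≢e = refl

  mark⁻ : ∀ {k} (g : Fin k → Bool) j {e} → upd g j true e ≡ false → g e ≡ false × j ≢ e
  mark⁻ g j {e} o with j ≟ e
  ... | yes _  = contradiction o λ ()
  ... | no j≢e = o , j≢e

  mark⁺ : ∀ {k} (g : Fin k → Bool) {j e} → j ≢ e → g e ≡ false → upd g j true e ≡ false
  mark⁺ g j≢e o = trans (upd-≢ g true j≢e) o

  -- The Hamming metric, scaled by `v`.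

  module Hamming (m q v : ℕ) where
    ham : Coloring m q → Coloring m q → ℕ
    ham σ τ = ∑ (allFin m) (λ e → ⟦ ¬? (lookup σ e ≟ lookup τ e) ⟧)

    d : Coloring m q → Coloring m q → ℕ
    d σ τ = v * ham σ τ

    d-refl : ∀ σ → d σ σ ≡ 0
    d-refl σ = trans (cong (v *_) (∑-0 (allFin m) (λ e → ⟦⟧-no (¬? (lookup σ e ≟ lookup σ e)) (λ h → h refl)))) (*-zeroʳ v)

    d-sym : ∀ σ τ → d σ τ ≡ d τ σ
    d-sym σ τ = cong (v *_) (∑-cong (allFin m) (λ e →
      ⟦⟧-cong (¬? (lookup σ e ≟ lookup τ e)) (¬? (lookup τ e ≟ lookup σ e)) (_∘ sym) (_∘ sym)))

    d-tri : ∀ σ τ ρ → d σ ρ ≤ d σ τ + d τ ρ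
    d-tri σ τ ρ = ≤-trans (*-monoʳ-≤ v (≤-trans (∑-mono (allFin m) pw) (≤-reflexive (∑-+ (allFin m) _ _))))
                          (≤-reflexive (*-distribˡ-+ v (ham σ τ) (ham τ ρ)))
      where
      pw : ∀ e → ⟦ ¬? (lookup σ e ≟ lookup ρ e) ⟧ ≤ ⟦ ¬? (lookup σ e ≟ lookup τ e) ⟧ + ⟦ ¬? (lookup τ e ≟ lookup ρ e) ⟧
      pw e with lookup σ e ≟ lookup τ e
      ... | yes p = ⟦⟧-mono (¬? (lookup σ e ≟ lookup ρ e)) (¬? (lookup τ e ≟ lookup ρ e)) (λ h h′ → h (trans p h′))
      ... | no _  = ≤-trans (⟦⟧≤1 (¬? (lookup σ e ≟ lookup ρ e))) (m≤m+n 1 _)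

    ham-update : ∀ σ j c → ham σ (σ [ j ]≔ c) ≤ 1
    ham-update σ j c = ≤-trans (∑-mono (allFin m) pw) (≤-reflexive (∑-δ j (λ _ → 1)))
      where
      pw : ∀ e → ⟦ ¬? (lookup σ e ≟ lookup (σ [ j ]≔ c) e) ⟧ ≤ ⟦ j ≟ e ⟧ * 1
      pw e with j ≟ e
      ... | yes _  = ⟦⟧≤1 (¬? (lookup σ e ≟ lookup (σ [ j ]≔ c) e))
      ... | no j≢e = ≤-reflexive (⟦⟧-no (¬? (lookup σ e ≟ lookup (σ [ j ]≔ c) e))
                       (λ h → h (sym (lookup∘update′ (j≢e ∘ sym) σ c))))

  -- Instances with pinned half edges and their valid colourings.

  module Coupling {n m q : ℕ} (G : Graph n m) (L : Fin m → Subset q) (v : ℕ) where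
    open Hamming m q v public
    open Transport (allColorings m q) _≟ᶜ_ ∑ᶜ-δ d d-refl d-sym d-tri public

    -- An edge that is off has its reported colour fixed, and towards its end w it acts on the other edges as if
    -- coloured dart e w. The colours at the two ends may differ from each other and from the reported one,
    -- so that a change of one pinned colour can be made one end at a time.
    record Instance : Set where
      field
        off  : Fin m → Bool
        rep  : Coloring m q
        dart : Fin m → Fin n → Fin q
    open Instance public

    Shows : Instance → Fin n → Fin q → Set
    Shows I w x = ∃ λ f → off I f ≡ true × Incident G f w × dart I f w ≡ x

    record Valid (I : Instance) (σ : Coloring m q) : Set where
      constructor valid
      field
        pinned : ∀ e → off I e ≡ true → lookup σ e ≡ lookup (rep I) e
        listed : ∀ e → off I e ≡ false → lookup σ e ∈ L e
        proper : ∀ e f w → off I e ≡ false → off I f ≡ false → e ≢ f → Incident G e w → Incident G f w →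
                 lookup σ e ≢ lookup σ f
        avoids : ∀ e w x → off I e ≡ false → Incident G e w → Shows I w x → lookup σ e ≢ x
    open Valid public

    abstract
      valid? : ∀ I σ → Dec (Valid I σ)
      valid? I σ = map′
        (λ (p , l , r , a) → valid p l r (λ e w x oe ie (f , of , if , eq) s → a e f w oe of ie if (trans s (sym eq))))
        (λ (valid p l r a) → p , l , r , (λ e f w oe of ie if → a e w _ oe ie (f , of , if , refl)))
        (all? (λ e → (off I e Bool.≟ true) →-dec (lookup σ e ≟ lookup (rep I) e))
         ×-dec all? (λ e → (off I e Bool.≟ false) →-dec (lookup σ e ∈? L e))
         ×-dec all? (λ e → all? λ f → all? λ w → (off I e Bool.≟ false) →-dec ((off I f Bool.≟ false) →-dec
                 (¬? (e ≟ f) →-dec (incident? G e w →-dec (incident? G f w →-dec ¬? (lookup σ e ≟ lookup σ f))))))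
         ×-dec all? (λ e → all? λ f → all? λ w → (off I e Bool.≟ false) →-dec ((off I f Bool.≟ true) →-dec
                 (incident? G e w →-dec (incident? G f w →-dec ¬? (lookup σ e ≟ dart I f w))))))

    χ : Instance → Measure
    χ I σ = ⟦ valid? I σ ⟧

    -- The second component lets Near be composed: an empty middle set would make W-trans useless.
    Near : Instance → Instance → ℕ → Set
    Near I J K = W (χ I) (χ J) K × (∣ χ J ∣ₘ ≡ 0 → ∣ χ I ∣ₘ ≡ 0)

    Near-trans : ∀ {I J M K K′} → Near I J K → Near J M K′ → Near I M (K + K′)
    Near-trans {I} {J} {M} (w , z) (w′ , z′) = glue , z ∘ z′
      where
      glue : W (χ I) (χ M) _
      glue with ≡0⊎NonZero ∣ χ J ∣ₘ
      ... | inj₁ e  = W-zeroˡ {ν = χ M} (z e)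
      ... | inj₂ nz = W-trans {ν = χ M} {{nz}} (λ σ → ⟦⟧-idem (valid? J σ)) w w′

    Shows-on : Instance → Instance → Set
    Shows-on I J = ∀ {w x} → Shows I w x → Shows J w x

    record RepDiffer (I J : Instance) (j : Fin m) : Set where
      field
        off≗  : ∀ e → off I e ≡ off J e
        off-j : off I j ≡ true
        rep≗  : ∀ e → off I e ≡ true → j ≢ e → lookup (rep I) e ≡ lookup (rep J) e
        shows : Shows-on I J
        shows⁻ : Shows-on J I

    RepDiffer-sym : ∀ {I J j} → RepDiffer I J j → RepDiffer J I j
    RepDiffer-sym {j = j} D = record
      { off≗ = λ e → sym (off≗ e) ; off-j = trans (sym (off≗ j)) off-j
      ; rep≗ = λ e o ne → sym (rep≗ e (trans (off≗ e) o) ne) ; shows = shows⁻ ; shows⁻ = shows }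
      where open RepDiffer D

    rep-valid : ∀ {I J j} → RepDiffer I J j → ∀ {σ} → Valid I σ → Valid J (σ [ j ]≔ lookup (rep J) j)
    rep-valid {I} {J} {j} D {σ} V = valid pin′
      (λ e o → subst (_∈ L e) (sym (same e o)) (listed V e (act e o)))
      (λ e f w o o′ ne ie if eq → proper V e f w (act e o) (act f o′) ne ie if (trans (sym (same e o)) (trans eq (same f o′))))
      (λ e w x o ie s eq → avoids V e w x (act e o) ie (shows⁻ s) (trans (sym (same e o)) eq))
      where
      open RepDiffer D
      c = lookup (rep J) j
      act : ∀ e → off J e ≡ false → off I e ≡ false
      act e o = trans (off≗ e) o
      same : ∀ e → off J e ≡ false → lookup (σ [ j ]≔ c) e ≡ lookup σ e
      same e o = lookup∘update′ (λ { refl → contradiction (trans (sym off-j) (act e o)) λ () }) σ c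
      pin′ : ∀ e → off J e ≡ true → lookup (σ [ j ]≔ c) e ≡ lookup (rep J) e
      pin′ e o with j ≟ e
      ... | yes refl = lookup∘update j σ c
      ... | no j≢e   = trans (lookup∘update′ (j≢e ∘ sym) σ c)
                         (trans (pinned V e (trans (off≗ e) o)) (rep≗ e (trans (off≗ e) o) j≢e))

    -- The reported colour of a pinned edge constrains no other edge. So overwriting it is a
    -- bijection between the valid colourings of `I` and of `J`, undone by writing the old colour
    -- back, and it moves each colouring by Hamming distance at most 1.
    rep-near : ∀ {I J j} → RepDiffer I J j → Near I J v
    rep-near {I} {J} {j} D = T-cong (T-* ∣ χ I ∣ₘ plan)
        (λ σ → cong (_* χ I σ) mass) (λ _ → refl)
        (≤-reflexive (trans (sym (*-assoc ∣ χ I ∣ₘ ∣ χ I ∣ₘ v)) (cong (λ t → ∣ χ I ∣ₘ * t * v) mass)))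
      , trans mass
      where
      open RepDiffer D
      cI = lookup (rep I) j
      cJ = lookup (rep J) j
      ω : Coloring m q → Coloring m q → ℕ
      ω σ τ = ⟦ (σ [ j ]≔ cJ) ≟ᶜ τ ⟧ * χ I σ
      back : ∀ {I J} → RepDiffer I J j → ∀ {σ} → Valid I σ → (σ [ j ]≔ lookup (rep J) j) [ j ]≔ lookup (rep I) j ≡ σ
      back {I} {J} D {σ} V = trans ([]≔-idempotent σ j)
        (trans (cong (σ [ j ]≔_) (sym (pinned V j (RepDiffer.off-j D)))) ([]≔-lookup σ j))
      flip : ∀ σ τ → ω σ τ ≡ ⟦ (τ [ j ]≔ cI) ≟ᶜ σ ⟧ * χ J τ
      flip σ τ = trans (sym (⟦⟧-* ((σ [ j ]≔ cJ) ≟ᶜ τ) (valid? I σ)))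
        (trans (⟦⟧-cong (((σ [ j ]≔ cJ) ≟ᶜ τ) ×-dec valid? I σ) (((τ [ j ]≔ cI) ≟ᶜ σ) ×-dec valid? J τ)
          (λ { (refl , V) → back D V , rep-valid D V })
          (λ { (refl , V) → back (RepDiffer-sym D) V , rep-valid (RepDiffer-sym D) V }))
        (⟦⟧-* ((τ [ j ]≔ cI) ≟ᶜ σ) (valid? J τ)))
      row : ∀ σ → ∑ᶜ (ω σ) ≡ χ I σ
      row σ = ∑ᶜ-δ (σ [ j ]≔ cJ) (λ _ → χ I σ)
      col : ∀ τ → ∑ᶜ (λ σ → ω σ τ) ≡ χ J τ
      col τ = trans (∑-cong (allColorings m q) (λ σ → flip σ τ)) (∑ᶜ-δ (τ [ j ]≔ cI) (λ _ → χ J τ))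
      mass : ∣ χ I ∣ₘ ≡ ∣ χ J ∣ₘ
      mass = trans (∑-cong (allColorings m q) (λ σ → sym (row σ)))
        (trans (∑-swap (allColorings m q) (allColorings m q) ω) (∑-cong (allColorings m q) col))
      pw : ∀ σ → ∑ᶜ (λ τ → ω σ τ * d σ τ) ≤ χ I σ * v
      pw σ = begin
        ∑ᶜ (λ τ → ω σ τ * d σ τ) ≡⟨ ∑-cong (allColorings m q) (λ τ → *-assoc ⟦ (σ [ j ]≔ cJ) ≟ᶜ τ ⟧ (χ I σ) (d σ τ)) ⟩
        ∑ᶜ (λ τ → ⟦ (σ [ j ]≔ cJ) ≟ᶜ τ ⟧ * (χ I σ * d σ τ)) ≡⟨ ∑ᶜ-δ (σ [ j ]≔ cJ) (λ τ → χ I σ * d σ τ) ⟩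
        χ I σ * (v * ham σ (σ [ j ]≔ cJ)) ≤⟨ *-monoʳ-≤ (χ I σ) (*-monoʳ-≤ v (ham-update σ j cJ)) ⟩
        χ I σ * (v * 1) ≡⟨ cong (χ I σ *_) (*-identityʳ v) ⟩
        χ I σ * v ∎
        where open ≤-Reasoning
      plan : T (χ I) (χ J) (∣ χ I ∣ₘ * v)
      plan = record
        { n = 1 ; ω = ω
        ; row = λ σ → trans (row σ) (sym (*-identityˡ (χ I σ)))
        ; col = λ τ → trans (col τ) (sym (*-identityˡ (χ J τ)))
        ; cost≤ = ≤-trans (∑-mono (allColorings m q) pw)
            (≤-reflexive (trans (∑-*ʳ (allColorings m q) (χ I) v) (sym (*-identityˡ _)))) }

    pin : Instance → Fin m → Fin q → (Fin n → Fin q) → Instance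
    pin I j r D = record { off = upd (off I) j true ; rep = rep I [ j ]≔ r ; dart = upd (dart I) j D }

    shows-new : ∀ I j r D {w} → Incident G j w → Shows (pin I j r D) w (D w)
    shows-new I j r D {w} ij = j , upd-≡ (off I) j true , ij , cong (λ g → g w) (upd-≡ (dart I) j D)

    shows-old : ∀ I j r D {w x} → off I j ≡ false → Shows I w x → Shows (pin I j r D) w x
    shows-old I j r D {w} oj (f , of , if , eq) =
      f , trans (upd-≢ (off I) true j≢f) of , if , trans (cong (λ g → g w) (upd-≢ (dart I) D j≢f)) eq
      where
      j≢f : j ≢ f
      j≢f refl = contradiction (trans (sym oj) of) λ ()

    shows-pin⁻ : ∀ I j r D {w x} → Shows (pin I j r D) w x → (Incident G j w × D w ≡ x) ⊎ Shows I w x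
    shows-pin⁻ I j r D (f , of , if , eq) with j ≟ f
    ... | yes refl = inj₁ (if , eq)
    ... | no _     = inj₂ (f , of , if , eq)

    Fix : Instance → Fin m → Fin q → Measure
    Fix I j x σ = ⟦ valid? I σ ×-dec (lookup σ j ≟ x) ⟧

    Fix-total : ∀ I j σ → χ I σ ≡ ∑ (allFin q) (λ x → Fix I j x σ)
    Fix-total I j σ = sym (trans (∑-cong (allFin q) (λ x →
        trans (⟦⟧-* (valid? I σ) (lookup σ j ≟ x)) (*-comm (χ I σ) _)))
      (∑-δ (lookup σ j) (λ _ → χ I σ)))

    -- Once `j` carries `x`, being proper against `j` and avoiding the darts of the pinned `j` are
    -- one condition on the other edges. The two hypotheses on `x` are for the converse: a pinned
    -- edge is no longer checked against its own list or against the colours shown at its ends.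
    Fix≡pin : ∀ I j x → off I j ≡ false → x ∈ L j → (∀ w y → Incident G j w → Shows I w y → x ≢ y) →
              ∀ σ → Fix I j x σ ≡ χ (pin I j x (λ _ → x)) σ
    Fix≡pin I j x oj x∈L clear σ = ⟦⟧-cong (valid? I σ ×-dec (lookup σ j ≟ x)) (valid? J σ) (to σ) (from σ)
      where
      J : Instance
      J = pin I j x (λ _ → x)
      to : ∀ σ → Valid I σ × lookup σ j ≡ x → Valid J σ
      to σ (V , eq) = valid pin′
        (λ e o → listed V e (proj₁ (mark⁻ (off I) j o)))
        (λ e f w o o′ → proper V e f w (proj₁ (mark⁻ (off I) j o)) (proj₁ (mark⁻ (off I) j o′)))
        avoid
        where
        pin′ : ∀ e → off J e ≡ true → lookup σ e ≡ lookup (rep J) e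
        pin′ e o with j ≟ e
        ... | yes refl = trans eq (sym (lookup∘update j (rep I) x))
        ... | no j≢e   = trans (pinned V e o) (sym (lookup∘update′ (j≢e ∘ sym) (rep I) x))
        avoid : ∀ e w y → off J e ≡ false → Incident G e w → Shows J w y → lookup σ e ≢ y
        avoid e w y o ie s with mark⁻ (off I) j o | shows-pin⁻ I j x (λ _ → x) s
        ... | oe , j≢e | inj₁ (ij , refl) = λ h → proper V e j w oe oj (j≢e ∘ sym) ie ij (trans h (sym eq))
        ... | oe , j≢e | inj₂ s′ = avoids V e w y oe ie s′
      from : ∀ σ → Valid J σ → Valid I σ × lookup σ j ≡ x
      from σ V = valid pin′ list prop avoid , σj
        where
        σj : lookup σ j ≡ x
        σj = trans (pinned V j (upd-≡ (off I) j true)) (lookup∘update j (rep I) x)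
        pin′ : ∀ e → off I e ≡ true → lookup σ e ≡ lookup (rep I) e
        pin′ e o = trans (pinned V e (trans (upd-≢ (off I) true j≢e) o)) (lookup∘update′ (j≢e ∘ sym) (rep I) x)
          where
          j≢e : j ≢ e
          j≢e refl = contradiction (trans (sym oj) o) λ ()
        list : ∀ e → off I e ≡ false → lookup σ e ∈ L e
        list e o with j ≟ e
        ... | yes refl = subst (_∈ L j) (sym σj) x∈L
        ... | no j≢e   = listed V e (mark⁺ (off I) j≢e o)
        vs-j : ∀ f w → off I f ≡ false → j ≢ f → Incident G f w → Incident G j w → lookup σ f ≢ lookup σ j
        vs-j f w o j≢f if ij h = avoids V f w x (mark⁺ (off I) j≢f o) if (shows-new I j x (λ _ → x) ij) (trans h σj)
        prop : ∀ e f w → off I e ≡ false → off I f ≡ false → e ≢ f → Incident G e w → Incident G f w → lookup σ e ≢ lookup σ f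
        prop e f w o o′ e≢f ie if h with j ≟ e | j ≟ f
        ... | yes refl | _        = vs-j f w o′ e≢f if ie (sym h)
        ... | no j≢e   | yes refl = vs-j e w o j≢e ie if h
        ... | no j≢e   | no j≢f   = proper V e f w (mark⁺ (off I) j≢e o) (mark⁺ (off I) j≢f o′) e≢f ie if h
        avoid : ∀ e w y → off I e ≡ false → Incident G e w → Shows I w y → lookup σ e ≢ y
        avoid e w y o ie s h with j ≟ e
        ... | yes refl = clear w y ie s (trans (sym σj) h)
        ... | no j≢e   = avoids V e w y (mark⁺ (off I) j≢e o) ie (shows-old I j x (λ _ → x) oj s) h

    -- A single valid colouring with `x` on `j` certifies both hypotheses of `Fix≡pin`; if there is
    -- none, the measure is 0.
    Fix-cases : ∀ I j x → off I j ≡ false → ∣ Fix I j x ∣ₘ ≡ 0 ⊎ (∀ σ → Fix I j x σ ≡ χ (pin I j x (λ _ → x)) σ)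
    Fix-cases I j x oj with ∑-witness (allColorings m q) (Fix I j x)
    ... | inj₁ z = inj₁ z
    ... | inj₂ (τ , h) with ⟦⟧≢0 (valid? I τ ×-dec (lookup τ j ≟ x)) h
    ...   | V , refl = inj₂ (Fix≡pin I j x oj (listed V j oj) (λ w y → avoids V j w y oj))

  upd-cong : ∀ {k} {A : Set} {f g : Fin k → A} → (∀ e → f e ≡ g e) → ∀ j x e → upd f j x e ≡ upd g j x e
  upd-cong h j x e with does (j ≟ e)
  ... | true  = refl
  ... | false = h e

  -- Incidence in a simple graph.

  module _ {n m : ℕ} (G : Graph n m) where

    two-ends : ∀ e {w w′} → Incident G e w → Incident G e w′ → w ≢ w′ → ends G e ≡ (w , w′) ⊎ ends G e ≡ (w′ , w)
    two-ends e (inj₁ p) (inj₁ p′) ne = contradiction (trans (sym p) p′) ne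
    two-ends e (inj₁ p) (inj₂ p′) ne = inj₁ (cong₂ _,_ p p′)
    two-ends e (inj₂ p) (inj₁ p′) ne = inj₂ (cong₂ _,_ p′ p)
    two-ends e (inj₂ p) (inj₂ p′) ne = contradiction (trans (sym p) p′) ne

    -- A pinned neighbour may show different colours at its two ends, yet `edeg` counts it once.
    -- This is why it must not be able to block a colour of `e` at both ends of `e`.
    share-once : ∀ {e f w w′} → e ≢ f → Incident G e w → Incident G e w′ → Incident G f w → Incident G f w′ → w ≡ w′
    share-once {e} {f} {w} {w′} e≢f ew ew′ fw fw′ with w ≟ w′
    ... | yes p = p
    ... | no ne with two-ends e ew ew′ ne | two-ends f fw fw′ ne
    ...   | inj₁ p | inj₁ p′ = contradiction (simple G e f (inj₁ (trans p (sym p′)))) e≢f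
    ...   | inj₁ p | inj₂ p′ rewrite p′ = contradiction (simple G e f (inj₂ (trans p (cong (λ (x , y) → y , x) (sym p′))))) e≢f
    ...   | inj₂ p | inj₁ p′ = contradiction (simple G e f (inj₂ (trans p (cong (λ (x , y) → y , x) (sym p′))))) e≢f
    ...   | inj₂ p | inj₂ p′ = contradiction (simple G e f (inj₁ (trans p (sym p′)))) e≢f

    other-end : ∀ {e u} → Incident G e u → ∃ λ w → u ≢ w × Incident G e w × (∀ x → Incident G e x → x ≡ u ⊎ x ≡ w)
    other-end {e} {u} (inj₁ refl) = _ , loopless G e , inj₂ refl , λ { x (inj₁ p) → inj₁ (sym p) ; x (inj₂ p) → inj₂ (sym p) }
    other-end {e} {u} (inj₂ refl) = _ , loopless G e ∘ sym , inj₁ refl , λ { x (inj₁ p) → inj₂ (sym p) ; x (inj₂ p) → inj₁ (sym p) }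

    adjacent : ∀ {e f w} → e ≢ f → Incident G e w → Incident G f w → Adjacent G e f
    adjacent ne (inj₁ refl) fw = ne , inj₁ fw
    adjacent ne (inj₂ refl) fw = ne , inj₂ fw

  -- The midpoint of a recolouring from `b` to `c`: the end `u` still shows the old colour, the
  -- other end already the new one.
  twoTone : ∀ {n q} → Fin n → Fin q → Fin q → Fin n → Fin q
  twoTone u b c w = if does (u ≟ w) then b else c

  twoTone-≡ : ∀ {n q} (u : Fin n) (b c : Fin q) → twoTone u b c u ≡ b
  twoTone-≡ u b c rewrite dec-true (u ≟ u) refl = refl

  twoTone-≢ : ∀ {n q} {u w : Fin n} (b c : Fin q) → u ≢ w → twoTone u b c w ≡ c
  twoTone-≢ {u = u} {w} b c u≢w rewrite dec-false (u ≟ w) u≢w = refl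

  -- Pairs of instances that differ by one colour shown at one vertex.

  module HalfEdge {n m q : ℕ} (G : Graph n m) (L : Fin m → Subset q) (v : ℕ) where
    open Coupling G L v public

    -- Only the set of colours shown at each vertex matters, not which edge shows which: in Differ-cross below
    -- the colours a, b, c′ at u become b, c, a, and this counts as a single change.
    record Differ (X Y : Instance) (u : Fin n) (a b : Fin q) : Set where
      field
        off≗  : ∀ e → off X e ≡ off Y e
        rep≗  : ∀ e → off X e ≡ true → lookup (rep X) e ≡ lookup (rep Y) e
        has-a : Shows X u a
        has-b : Shows Y u b
        cov₁  : ∀ {w x} → Shows X w x → (w ≡ u × x ≡ a) ⊎ Shows Y w x
        cov₂  : ∀ {w x} → Shows Y w x → (w ≡ u × x ≡ b) ⊎ Shows X w x

    Differ-sym : ∀ {X Y u a b} → Differ X Y u a b → Differ Y X u b a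
    Differ-sym D = record
      { off≗ = λ e → sym (off≗ e) ; rep≗ = λ e o → sym (rep≗ e (trans (off≗ e) o))
      ; has-a = has-b ; has-b = has-a ; cov₁ = cov₂ ; cov₂ = cov₁ }
      where open Differ D

    rep-pin : ∀ {X Y : Instance} j c → (∀ e → off X e ≡ true → lookup (rep X) e ≡ lookup (rep Y) e) →
              ∀ e → upd (off X) j true e ≡ true → lookup (rep X [ j ]≔ c) e ≡ lookup (rep Y [ j ]≔ c) e
    rep-pin {X} {Y} j c h e o with j ≟ e
    ... | yes refl = trans (lookup∘update j (rep X) c) (sym (lookup∘update j (rep Y) c))
    ... | no j≢e   = trans (lookup∘update′ (j≢e ∘ sym) (rep X) c)
                       (trans (h e o) (sym (lookup∘update′ (j≢e ∘ sym) (rep Y) c)))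

    Differ-pin : ∀ {X Y u a b} l r D → off X l ≡ false → Differ X Y u a b → Differ (pin X l r D) (pin Y l r D) u a b
    Differ-pin {X} {Y} l r D ol Δ = record
      { off≗ = upd-cong off≗ l true
      ; rep≗ = rep-pin {X} {Y} l r rep≗
      ; has-a = shows-old X l r D ol has-a
      ; has-b = shows-old Y l r D ol′ has-b
      ; cov₁ = λ s → [ (λ { (il , refl) → inj₂ (shows-new Y l r D il) })
                     , (λ s′ → [ inj₁ , inj₂ ∘ shows-old Y l r D ol′ ]′ (cov₁ s′)) ]′ (shows-pin⁻ X l r D s)
      ; cov₂ = λ s → [ (λ { (il , refl) → inj₂ (shows-new X l r D il) })
                     , (λ s′ → [ inj₁ , inj₂ ∘ shows-old X l r D ol ]′ (cov₂ s′)) ]′ (shows-pin⁻ Y l r D s) }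
      where
      open Differ Δ
      ol′ : off Y l ≡ false
      ol′ = trans (sym (off≗ l)) ol

    -- The first half of a recolouring. It takes place at the end away from `u`, so that the second
    -- half, at `u`, can be merged with a discrepancy that is already there.
    Differ-tone : ∀ X j r {u w} b c → off X j ≡ false → Incident G j u → u ≢ w → Incident G j w →
                  (∀ x → Incident G j x → x ≡ u ⊎ x ≡ w) →
                  Differ (pin X j r (λ _ → b)) (pin X j r (twoTone u b c)) w b c
    Differ-tone X j r {u} {w} b c oj iu u≢w iw only = record
      { off≗ = λ _ → refl ; rep≗ = λ _ _ → refl
      ; has-a = shows-new X j r (λ _ → b) iw
      ; has-b = subst (Shows M w) (twoTone-≢ b c u≢w) (shows-new X j r (twoTone u b c) iw)
      ; cov₁ = λ s → [ from₁ , inj₂ ∘ shows-old X j r (twoTone u b c) oj ]′ (shows-pin⁻ X j r (λ _ → b) s)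
      ; cov₂ = λ s → [ from₂ , inj₂ ∘ shows-old X j r (λ _ → b) oj ]′ (shows-pin⁻ X j r (twoTone u b c) s) }
      where
      M M₀ : Instance
      M  = pin X j r (twoTone u b c)
      M₀ = pin X j r (λ _ → b)
      from₁ : ∀ {w′ x} → Incident G j w′ × b ≡ x → (w′ ≡ w × x ≡ b) ⊎ Shows M w′ x
      from₁ (ij , refl) with only _ ij
      ... | inj₁ refl = inj₂ (subst (Shows M u) (twoTone-≡ u b c) (shows-new X j r (twoTone u b c) iu))
      ... | inj₂ refl = inj₁ (refl , refl)
      from₂ : ∀ {w′ x} → Incident G j w′ × twoTone u b c w′ ≡ x → (w′ ≡ w × x ≡ c) ⊎ Shows M₀ w′ x
      from₂ (ij , refl) with only _ ij
      ... | inj₁ refl = inj₂ (subst (Shows M₀ u) (sym (twoTone-≡ u b c)) (shows-new X j r (λ _ → b) iu))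
      ... | inj₂ refl = inj₁ (refl , twoTone-≢ b c u≢w)

    module Pinned-pairs {X Y u a b} (Δ : Differ X Y u a b) where
      open Differ Δ

      offY : ∀ {j} → off X j ≡ false → off Y j ≡ false
      offY {j} o = trans (sym (off≗ j)) o

      -- At `u` one side shows `a` and, through `j`, `b`; the other shows `b` and, through `j`, `a`.
      -- As sets these agree, so only the far end of `j` is left.
      Differ-same : ∀ {j w} → off X j ≡ false → Incident G j u → Incident G j w →
                    (∀ x → Incident G j x → x ≡ u ⊎ x ≡ w) →
                    Differ (pin X j a (λ _ → b)) (pin Y j a (λ _ → a)) w b a
      Differ-same {j} {w} oj iu iw only = record
        { off≗ = upd-cong off≗ j true ; rep≗ = rep-pin {X} {Y} j a rep≗
        ; has-a = shows-new X j a (λ _ → b) iw ; has-b = shows-new Y j a (λ _ → a) iw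
        ; cov₁ = λ s → [ (λ { (ij , refl) → [ (λ { refl → inj₂ (oldY has-b) }) , (λ { refl → inj₁ (refl , refl) }) ]′ (only _ ij) })
                       , (λ s′ → inj₂ ([ (λ { (refl , refl) → shows-new Y j a (λ _ → a) iu }) , oldY ]′ (cov₁ s′))) ]′
                       (shows-pin⁻ X j a (λ _ → b) s)
        ; cov₂ = λ s → [ (λ { (ij , refl) → [ (λ { refl → inj₂ (oldX has-a) }) , (λ { refl → inj₁ (refl , refl) }) ]′ (only _ ij) })
                       , (λ s′ → inj₂ ([ (λ { (refl , refl) → shows-new X j a (λ _ → b) iu }) , oldX ]′ (cov₂ s′))) ]′
                       (shows-pin⁻ Y j a (λ _ → a) s) }
        where
        oldX : ∀ {w x} → Shows X w x → Shows (pin X j a (λ _ → b)) w x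
        oldX = shows-old X j a (λ _ → b) oj
        oldY : ∀ {w x} → Shows Y w x → Shows (pin Y j a (λ _ → a)) w x
        oldY = shows-old Y j a (λ _ → a) (offY oj)

      -- The far end of `j` shows `c` on both sides. At `u` the colours are `a`, `b` against `b`,
      -- `c`, where the `b` comes from `j` on the left and from `Y` on the right.
      Differ-onto : ∀ {j w} c → off X j ≡ false → Incident G j u → u ≢ w → Incident G j w →
                    (∀ x → Incident G j x → x ≡ u ⊎ x ≡ w) →
                    Differ (pin X j c (twoTone u b c)) (pin Y j c (λ _ → c)) u a c
      Differ-onto {j} {w} c oj iu u≢w iw only = record
        { off≗ = upd-cong off≗ j true ; rep≗ = rep-pin {X} {Y} j c rep≗
        ; has-a = oldX has-a ; has-b = shows-new Y j c (λ _ → c) iu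
        ; cov₁ = λ s → [ from₁ , (λ s′ → [ inj₁ , inj₂ ∘ oldY ]′ (cov₁ s′)) ]′ (shows-pin⁻ X j c (twoTone u b c) s)
        ; cov₂ = λ s → [ from₂ , (λ s′ → inj₂ ([ (λ { (refl , refl) → new-u }) , oldX ]′ (cov₂ s′))) ]′
                       (shows-pin⁻ Y j c (λ _ → c) s) }
        where
        M N : Instance
        M = pin X j c (twoTone u b c)
        N = pin Y j c (λ _ → c)
        oldX : ∀ {w x} → Shows X w x → Shows M w x
        oldX = shows-old X j c (twoTone u b c) oj
        oldY : ∀ {w x} → Shows Y w x → Shows N w x
        oldY = shows-old Y j c (λ _ → c) (offY oj)
        new-u : Shows M u b
        new-u = subst (Shows M u) (twoTone-≡ u b c) (shows-new X j c (twoTone u b c) iu)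
        new-w : Shows M w c
        new-w = subst (Shows M w) (twoTone-≢ b c u≢w) (shows-new X j c (twoTone u b c) iw)
        from₁ : ∀ {w′ x} → Incident G j w′ × twoTone u b c w′ ≡ x → (w′ ≡ u × x ≡ a) ⊎ Shows N w′ x
        from₁ (ij , refl) with only _ ij
        ... | inj₁ refl = inj₂ (subst (Shows N u) (sym (twoTone-≡ u b c)) (oldY has-b))
        ... | inj₂ refl = inj₂ (subst (Shows N w) (sym (twoTone-≢ b c u≢w)) (shows-new Y j c (λ _ → c) iw))
        from₂ : ∀ {w′ x} → Incident G j w′ × c ≡ x → (w′ ≡ u × x ≡ c) ⊎ Shows M w′ x
        from₂ (ij , refl) with only _ ij
        ... | inj₁ refl = inj₁ (refl , refl)
        ... | inj₂ refl = inj₂ new-w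

      -- The far ends already agree: `c` for `j` and `a` for `l`. At `u` the `a` of `X` is supplied
      -- by `l` on the right, and the `b` of `Y` by `j` on the left, so `c′` against `c` is all that
      -- remains.
      Differ-cross : ∀ {j l w w′} c c′ → j ≢ l → off X j ≡ false → off X l ≡ false →
        Incident G j u → u ≢ w  → Incident G j w  → (∀ x → Incident G j x → x ≡ u ⊎ x ≡ w) →
        Incident G l u → u ≢ w′ → Incident G l w′ → (∀ x → Incident G l x → x ≡ u ⊎ x ≡ w′) →
        Differ (pin (pin X j c (twoTone u b c)) l a (twoTone u c′ a)) (pin (pin Y l a (λ _ → a)) j c (λ _ → c)) u c′ c
      Differ-cross {j} {l} {w} {w′} c c′ j≢l oj ol iju u≢w ijw onlyj ilu u≢w′ ilw′ onlyl = record
        { off≗ = off′ ; rep≗ = rep′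
        ; has-a = new-lu ; has-b = shows-new N₁ j c (λ _ → c) iju
        ; cov₁ = λ s → [ from-l , (λ s′ → inj₂ ([ from-j
                       , (λ s″ → [ (λ { (refl , refl) → oldN (shows-new Y l a (λ _ → a) ilu) }) , oldN ∘ oldY ]′ (cov₁ s″)) ]′
                         (shows-pin⁻ X j c (twoTone u b c) s′))) ]′ (shows-pin⁻ M₁ l a (twoTone u c′ a) s)
        ; cov₂ = λ s → [ to-j , (λ s′ → inj₂ ([ to-l
                       , (λ s″ → [ (λ { (refl , refl) → oldM new-ju }) , oldM ∘ oldX ]′ (cov₂ s″)) ]′
                         (shows-pin⁻ Y l a (λ _ → a) s′))) ]′ (shows-pin⁻ N₁ j c (λ _ → c) s) }
        where
        M₁ N₁ M N : Instance
        M₁ = pin X j c (twoTone u b c)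
        M  = pin M₁ l a (twoTone u c′ a)
        N₁ = pin Y l a (λ _ → a)
        N  = pin N₁ j c (λ _ → c)
        oldX : ∀ {w x} → Shows X w x → Shows M₁ w x
        oldX = shows-old X j c (twoTone u b c) oj
        oldM : ∀ {w x} → Shows M₁ w x → Shows M w x
        oldM = shows-old M₁ l a (twoTone u c′ a) (mark⁺ (off X) j≢l ol)
        oldY : ∀ {w x} → Shows Y w x → Shows N₁ w x
        oldY = shows-old Y l a (λ _ → a) (offY ol)
        oldN : ∀ {w x} → Shows N₁ w x → Shows N w x
        oldN = shows-old N₁ j c (λ _ → c) (mark⁺ (off Y) (j≢l ∘ sym) (offY oj))
        new-lu : Shows M u c′
        new-lu = subst (Shows M u) (twoTone-≡ u c′ a) (shows-new M₁ l a (twoTone u c′ a) ilu)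
        new-lw : Shows M w′ a
        new-lw = subst (Shows M w′) (twoTone-≢ c′ a u≢w′) (shows-new M₁ l a (twoTone u c′ a) ilw′)
        new-ju : Shows M₁ u b
        new-ju = subst (Shows M₁ u) (twoTone-≡ u b c) (shows-new X j c (twoTone u b c) iju)
        new-jw : Shows M₁ w c
        new-jw = subst (Shows M₁ w) (twoTone-≢ b c u≢w) (shows-new X j c (twoTone u b c) ijw)
        from-l : ∀ {y x} → Incident G l y × twoTone u c′ a y ≡ x → (y ≡ u × x ≡ c′) ⊎ Shows N y x
        from-l (il , refl) with onlyl _ il
        ... | inj₁ refl = inj₁ (refl , twoTone-≡ u c′ a)
        ... | inj₂ refl = inj₂ (subst (Shows N w′) (sym (twoTone-≢ c′ a u≢w′)) (oldN (shows-new Y l a (λ _ → a) ilw′)))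
        from-j : ∀ {y x} → Incident G j y × twoTone u b c y ≡ x → Shows N y x
        from-j (ij , refl) with onlyj _ ij
        ... | inj₁ refl = subst (Shows N u) (sym (twoTone-≡ u b c)) (oldN (oldY has-b))
        ... | inj₂ refl = subst (Shows N w) (sym (twoTone-≢ b c u≢w)) (shows-new N₁ j c (λ _ → c) ijw)
        to-j : ∀ {y x} → Incident G j y × c ≡ x → (y ≡ u × x ≡ c) ⊎ Shows M y x
        to-j (ij , refl) with onlyj _ ij
        ... | inj₁ refl = inj₁ (refl , refl)
        ... | inj₂ refl = inj₂ (oldM new-jw)
        to-l : ∀ {y x} → Incident G l y × a ≡ x → Shows M y x
        to-l (il , refl) with onlyl _ il
        ... | inj₁ refl = oldM (oldX has-a)
        ... | inj₂ refl = new-lw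
        off′ : ∀ e → upd (upd (off X) j true) l true e ≡ upd (upd (off Y) l true) j true e
        off′ e with j ≟ e | l ≟ e
        ... | yes _ | yes _ = refl
        ... | yes _ | no _  = refl
        ... | no _  | yes _ = refl
        ... | no _  | no _  = off≗ e
        rep′ : ∀ e → off M e ≡ true → lookup (rep M) e ≡ lookup (rep N) e
        rep′ e o with j ≟ e | l ≟ e
        ... | yes refl | yes refl = contradiction refl j≢l
        ... | yes refl | no l≢e   = trans (lookup∘update′ (l≢e ∘ sym) (rep X [ j ]≔ c) a)
                (trans (lookup∘update j (rep X) c) (sym (lookup∘update j (rep Y [ l ]≔ a) c)))
        ... | no j≢e   | yes refl = trans (lookup∘update l (rep X [ j ]≔ c) a)
                (trans (sym (lookup∘update l (rep Y) a)) (sym (lookup∘update′ (j≢e ∘ sym) (rep Y [ l ]≔ a) c)))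
        ... | no j≢e   | no l≢e   = trans (lookup∘update′ (l≢e ∘ sym) (rep X [ j ]≔ c) a)
                (trans (lookup∘update′ (j≢e ∘ sym) (rep X) c) (trans (rep≗ e o)
                (sym (trans (lookup∘update′ (j≢e ∘ sym) (rep Y [ l ]≔ a) c) (lookup∘update′ (l≢e ∘ sym) (rep Y) a)))))

  -- The half-edge bound, by recursion on the number of free edges.

  module Recursion {n m q : ℕ} (G : Graph n m) (L : Fin m → Subset q) (v β F Δ : ℕ) {{_ : NonZero β}}
    (wide : ∀ e → edeg G e + suc β ≤ ∣ L e ∣) (maxdeg : MaxDegreeAtMost G Δ) (Δ≤ : Δ * (v + F) ≤ β * F) where
    open HalfEdge G L v

    ActiveAt : Instance → Fin n → Fin m → Set
    ActiveAt I u j = off I j ≡ false × Incident G j u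

    activeAt? : ∀ I u j → Dec (ActiveAt I u j)
    activeAt? I u j = (off I j Bool.≟ false) ×-dec incident? G j u

    Part : Instance → Fin n → Fin q → Fin m → Measure
    Part I u c j σ = ⟦ activeAt? I u j ×-dec (valid? I σ ×-dec (lookup σ j ≟ c)) ⟧

    Unused : Instance → Fin n → Fin q → Coloring m q → Set
    Unused I u c σ = Valid I σ × (∀ e → ActiveAt I u e → lookup σ e ≢ c)

    unused? : ∀ I u c σ → Dec (Unused I u c σ)
    unused? I u c σ = valid? I σ ×-dec all? (λ e → activeAt? I u e →-dec ¬? (lookup σ e ≟ c))

    Free : Instance → Fin n → Fin q → Measure
    Free I u c σ = ⟦ unused? I u c σ ⟧

    -- The parts are disjoint because a valid colouring is proper at `u`: two free edges there
    -- cannot both carry `c`.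
    χ-split : ∀ I u c σ → χ I σ ≡ Free I u c σ + ∑ (allFin m) (λ j → Part I u c j σ)
    χ-split I u c σ = go (valid? I σ) (any? λ j → activeAt? I u j ×-dec (lookup σ j ≟ c))
      where
      part? : ∀ j → Dec (ActiveAt I u j × Valid I σ × lookup σ j ≡ c)
      part? j = activeAt? I u j ×-dec (valid? I σ ×-dec (lookup σ j ≟ c))
      go : Dec (Valid I σ) → Dec (∃ λ j → ActiveAt I u j × lookup σ j ≡ c) →
           χ I σ ≡ Free I u c σ + ∑ (allFin m) (λ j → Part I u c j σ)
      go (no ¬V) _ = trans (⟦⟧-no (valid? I σ) ¬V) (sym (cong₂ _+_ (⟦⟧-no (unused? I u c σ) (¬V ∘ proj₁))
        (∑-0 (allFin m) (λ j → ⟦⟧-no (part? j) (λ (_ , V , _) → ¬V V)))))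
      go (yes V) (no ¬j) = trans (⟦⟧-yes (valid? I σ) V) (sym (cong₂ _+_
        (⟦⟧-yes (unused? I u c σ) (V , λ e at eq → ¬j (e , at , eq)))
        (∑-0 (allFin m) (λ j → ⟦⟧-no (part? j) (λ (at , _ , eq) → ¬j (j , at , eq))))))
      go (yes V) (yes (j , (oj , ij) , eq)) = trans (⟦⟧-yes (valid? I σ) V) (sym (cong₂ _+_
        (⟦⟧-no (unused? I u c σ) (λ (_ , h) → h j (oj , ij) eq))
        (trans (∑-cong (allFin m) (λ e → trans (⟦⟧-cong (part? e) (j ≟ e) (only e) (λ { refl → (oj , ij) , V , eq }))
                                               (sym (*-identityʳ ⟦ j ≟ e ⟧))))
               (∑-δ j (λ _ → 1)))))
        where
        only : ∀ e → ActiveAt I u e × Valid I σ × lookup σ e ≡ c → j ≡ e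
        only e ((oe , ie) , _ , eq′) with j ≟ e
        ... | yes p = p
        ... | no j≢e = contradiction (trans eq (sym eq′)) (proper V j e u oj oe j≢e ij ie)

    module _ (I : Instance) (σ : Coloring m q) (j : Fin m) where

      colourAt : Fin m → Fin n → Fin q
      colourAt f w = if off I f then dart I f w else lookup σ f

      -- One entry per neighbour of `j`, free or pinned, read at the end it shares with `j`. The
      -- length is therefore `edeg G j`, however many edges have been pinned.
      blocked : List (Fin q)
      blocked = List.map colour (filter (adjacent? G j) (allFin m))
        where
        colour : Fin m → Fin q
        colour f = if does (incident? G f (proj₁ (ends G j))) then colourAt f (proj₁ (ends G j)) else colourAt f (proj₂ (ends G j))

      length-blocked : length blocked ≡ edeg G j
      length-blocked = length-map _ (filter (adjacent? G j) (allFin m))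

      ∈-blocked : ∀ {f w} → j ≢ f → Incident G j w → Incident G f w → colourAt f w ∈ₗ blocked
      ∈-blocked {f} {w} ne jw fw = subst (_∈ₗ blocked) (colour≡ jw (incident? G f (proj₁ (ends G j))))
          (∈-map⁺ _ (∈-filter⁺ (adjacent? G j) (∈-allFin f) (adjacent G ne jw fw)))
        where
        colour≡ : Incident G j w → (p : Dec (Incident G f (proj₁ (ends G j)))) →
                  (if does p then colourAt f (proj₁ (ends G j)) else colourAt f (proj₂ (ends G j))) ≡ colourAt f w
        colour≡ _           (yes p) = cong (colourAt f) (share-once G ne (inj₁ refl) jw p fw)
        colour≡ (inj₁ refl) (no ¬p) = contradiction fw ¬p
        colour≡ (inj₂ refl) (no ¬p) = refl

      recolour : ∀ {x} → off I j ≡ false → Valid I σ → x ∈ L j → ¬ x ∈ₗ blocked → Valid I (σ [ j ]≔ x)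
      recolour {x} oj V x∈L x∉ = valid pin′ list prop avoid
        where
        new : lookup (σ [ j ]≔ x) j ≡ x
        new = lookup∘update j σ x
        old : ∀ {e} → j ≢ e → lookup (σ [ j ]≔ x) e ≡ lookup σ e
        old ne = lookup∘update′ (ne ∘ sym) σ x
        pin′ : ∀ e → off I e ≡ true → lookup (σ [ j ]≔ x) e ≡ lookup (rep I) e
        pin′ e o = trans (old (λ { refl → contradiction (trans (sym oj) o) λ () })) (pinned V e o)
        list : ∀ e → off I e ≡ false → lookup (σ [ j ]≔ x) e ∈ L e
        list e o with j ≟ e
        ... | yes refl = subst (_∈ L j) (sym new) x∈L
        ... | no ne    = subst (_∈ L e) (sym (old ne)) (listed V e o)
        vs-j : ∀ {f w} → off I f ≡ false → j ≢ f → Incident G j w → Incident G f w → x ≢ lookup σ f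
        vs-j {f} {w} of ne jw fw refl = x∉ (subst (_∈ₗ blocked)
          (cong (λ t → if t then dart I f w else lookup σ f) of) (∈-blocked ne jw fw))
        prop : ∀ e f w → off I e ≡ false → off I f ≡ false → e ≢ f → Incident G e w → Incident G f w →
               lookup (σ [ j ]≔ x) e ≢ lookup (σ [ j ]≔ x) f
        prop e f w oe of ne ew fw eq with j ≟ e | j ≟ f
        ... | yes refl | yes refl = ne refl
        ... | yes refl | no j≢f   = vs-j of j≢f ew fw (trans (sym new) (trans eq (old j≢f)))
        ... | no j≢e   | yes refl = vs-j oe j≢e fw ew (trans (sym new) (trans (sym eq) (old j≢e)))
        ... | no j≢e   | no j≢f   = proper V e f w oe of ne ew fw (trans (sym (old j≢e)) (trans eq (old j≢f)))
        avoid : ∀ e w y → off I e ≡ false → Incident G e w → Shows I w y → lookup (σ [ j ]≔ x) e ≢ y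
        avoid e w y oe ew s@(f , of , fw , refl) eq with j ≟ e
        ... | no ne    = avoids V e w y oe ew s (trans (sym (old ne)) eq)
        ... | yes refl = x∉ (subst (_∈ₗ blocked)
                (trans (cong (λ t → if t then dart I f w else lookup σ f) of) (trans (sym eq) new)) (∈-blocked j≢f ew fw))
          where
          j≢f : j ≢ f
          j≢f refl = contradiction (trans (sym oe) of) λ ()

    -- The list of j leaves at least β colours other than c and those of the neighbours of j.
    Part≤Free : ∀ I u c j → β * ∣ Part I u c j ∣ₘ ≤ ∣ Free I u c ∣ₘ
    -- Double counting over the families `σ [ j ]≔ x` with `x` varying: in each, at most one member
    -- lies in `Part`, namely the one with colour `c`, and if it does then at least `β` members lie
    -- in `Free`.
    Part≤Free I u c j = *-cancelˡ-≤ q {{nonZeroIndex c}} (begin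
      q * (β * ∣ Part I u c j ∣ₘ)   ≡⟨ alg q β ∣ Part I u c j ∣ₘ ⟩
      β * (q * ∣ Part I u c j ∣ₘ)   ≡⟨ cong (β *_) (sym (∑ᶜ-recolor j (Part I u c j))) ⟩
      β * ∑ᶜ (λ σ → ∑ (allFin q) (λ x → Part I u c j (σ [ j ]≔ x))) ≡⟨ sym (∑-*ˡ (allColorings m q) β _) ⟩
      ∑ᶜ (λ σ → β * ∑ (allFin q) (λ x → Part I u c j (σ [ j ]≔ x))) ≤⟨ ∑-mono (allColorings m q) pw ⟩
      ∑ᶜ (λ σ → ∑ (allFin q) (λ x → Free I u c (σ [ j ]≔ x)))       ≡⟨ ∑ᶜ-recolor j (Free I u c) ⟩
      q * ∣ Free I u c ∣ₘ ∎)
      where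
      open ≤-Reasoning
      alg : ∀ a b c → a * (b * c) ≡ b * (a * c)
      alg = solve-∀
      part? : ∀ σ → Dec (ActiveAt I u j × Valid I σ × lookup σ j ≡ c)
      part? σ = activeAt? I u j ×-dec (valid? I σ ×-dec (lookup σ j ≟ c))
      collapse : ∀ σ → ∑ (allFin q) (λ x → Part I u c j (σ [ j ]≔ x)) ≡ Part I u c j (σ [ j ]≔ c)
      collapse σ = trans (∑-cong (allFin q) at) (∑-δ c (λ x → Part I u c j (σ [ j ]≔ x)))
        where
        at : ∀ x → Part I u c j (σ [ j ]≔ x) ≡ ⟦ c ≟ x ⟧ * Part I u c j (σ [ j ]≔ x)
        at x with c ≟ x
        ... | yes _ = sym (+-identityʳ _)
        ... | no c≢x = ⟦⟧-no (part? (σ [ j ]≔ x)) (λ (_ , _ , eq) → c≢x (trans (sym eq) (lookup∘update j σ x)))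
      pw : ∀ σ → β * ∑ (allFin q) (λ x → Part I u c j (σ [ j ]≔ x)) ≤ ∑ (allFin q) (λ x → Free I u c (σ [ j ]≔ x))
      pw σ = ≤-trans (≤-reflexive (cong (β *_) (collapse σ))) (go (part? (σ [ j ]≔ c)))
        where
        τ = σ [ j ]≔ c
        go : (p : Dec (ActiveAt I u j × Valid I τ × lookup τ j ≡ c)) → β * ⟦ p ⟧ ≤ ∑ (allFin q) (λ x → Free I u c (σ [ j ]≔ x))
        go (no _) = ≤-trans (≤-reflexive (*-zeroʳ β)) z≤n
        go (yes ((oj , ij) , V , τj)) = ≤-trans (≤-reflexive (*-identityʳ β))
            (≤-trans enough (∑-mono (allFin q) (λ x → ⟦⟧-mono (∈∉? (L j) bs x) (unused? I u c (σ [ j ]≔ x)) (good x))))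
          where
          -- The forbidden colours number at most `edeg` + 1. The extra one is `c` itself, and it is
          -- paid by the `suc` in `suc β`.
          bs = c ∷ blocked I τ j
          enough : β ≤ ∑ (allFin q) (λ x → ⟦ ∈∉? (L j) bs x ⟧)
          enough = +-cancelʳ-≤ (suc (edeg G j)) β _ (begin
            β + suc (edeg G j)        ≡⟨ alg′ β (edeg G j) ⟩
            edeg G j + suc β          ≤⟨ wide j ⟩
            ∣ L j ∣                   ≤⟨ size-minus (L j) bs ⟩
            ∑ (allFin q) (λ x → ⟦ ∈∉? (L j) bs x ⟧) + length bs
              ≡⟨ cong (λ t → ∑ (allFin q) (λ x → ⟦ ∈∉? (L j) bs x ⟧) + suc t) (length-blocked I τ j) ⟩
            ∑ (allFin q) (λ x → ⟦ ∈∉? (L j) bs x ⟧) + suc (edeg G j) ∎)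
            where
            alg′ : ∀ a b → a + suc b ≡ b + suc a
            alg′ a b = trans (+-suc a b) (trans (cong suc (+-comm a b)) (sym (+-suc b a)))
          good : ∀ x → x ∈ L j × ¬ x ∈ₗ bs → Unused I u c (σ [ j ]≔ x)
          good x (x∈L , x∉) = subst (Unused I u c) ([]≔-idempotent σ j)
            (recolour I τ j oj V x∈L (x∉ ∘ there) , avoid-c)
            where
            avoid-c : ∀ e → ActiveAt I u e → lookup (τ [ j ]≔ x) e ≢ c
            avoid-c e (oe , ie) eq with j ≟ e
            ... | yes refl = x∉ (here (trans (sym (lookup∘update j τ x)) eq))
            ... | no j≢e   = proper V j e u oj oe j≢e ij ie
                  (trans τj (trans (sym eq) (lookup∘update′ (j≢e ∘ sym) τ x)))

    Part-inactive : ∀ I u c j → ¬ ActiveAt I u j → ∣ Part I u c j ∣ₘ ≡ 0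
    Part-inactive I u c j ¬at = ∑-0 (allColorings m q) (λ σ →
      ⟦⟧-no (activeAt? I u j ×-dec (valid? I σ ×-dec (lookup σ j ≟ c))) (¬at ∘ proj₁))

    Part-cases : ∀ I u c j → ∣ Part I u c j ∣ₘ ≡ 0 ⊎
                 (ActiveAt I u j × (∀ σ → Part I u c j σ ≡ χ (pin I j c (λ _ → c)) σ))
    Part-cases I u c j with activeAt? I u j
    ... | no ¬at = inj₁ (Part-inactive I u c j ¬at)
    ... | yes at with Fix-cases I j c (proj₁ at)
    ...   | inj₁ z = inj₁ (trans (∑-cong (allColorings m q) (Part≡Fix at)) z)
      where
      Part≡Fix : ActiveAt I u j → ∀ σ → Part I u c j σ ≡ Fix I j c σ
      Part≡Fix at σ = ⟦⟧-cong (activeAt? I u j ×-dec (valid? I σ ×-dec (lookup σ j ≟ c))) (valid? I σ ×-dec (lookup σ j ≟ c)) proj₂ (at ,_)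
    ...   | inj₂ h = inj₂ (at , λ σ → trans (⟦⟧-cong (activeAt? I u j ×-dec (valid? I σ ×-dec (lookup σ j ≟ c)))
                                                     (valid? I σ ×-dec (lookup σ j ≟ c)) proj₂ (at ,_)) (h σ))

    W-via : ∀ {μ ν I J K} → (∀ σ → μ σ ≡ χ I σ) → (∀ σ → ν σ ≡ χ J σ) → W (χ I) (χ J) K → W μ ν K
    W-via {I = I} {J} e e′ = W-cong {χ I} {_} {χ J} (λ σ → sym (e σ)) (λ σ → sym (e′ σ))

    active : (Fin m → Bool) → ℕ
    active g = ∑ (allFin m) (λ e → ⟦ g e Bool.≟ false ⟧)

    active-mark : ∀ g j → g j ≡ false → active (upd g j true) < active g
    active-mark g j gj = begin
      suc (active (upd g j true)) ≡⟨ +-comm 1 _ ⟩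
      active (upd g j true) + 1   ≡⟨ cong (active (upd g j true) +_) (sym (∑-δ j (λ _ → 1))) ⟩
      active (upd g j true) + ∑ (allFin m) (λ e → ⟦ j ≟ e ⟧ * 1) ≡⟨ sym (∑-+ (allFin m) _ _) ⟩
      ∑ (allFin m) (λ e → ⟦ upd g j true e Bool.≟ false ⟧ + ⟦ j ≟ e ⟧ * 1) ≤⟨ ∑-mono (allFin m) pw ⟩
      active g ∎
      where
      open ≤-Reasoning
      pw : ∀ e → ⟦ upd g j true e Bool.≟ false ⟧ + ⟦ j ≟ e ⟧ * 1 ≤ ⟦ g e Bool.≟ false ⟧
      pw e with j ≟ e
      ... | yes refl = ≤-reflexive (sym (⟦⟧-yes (g j Bool.≟ false) gj))
      ... | no _     = ≤-reflexive (+-identityʳ _)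

    report : ∀ I j r r′ D → Near (pin I j r D) (pin I j r′ D) v
    report I j r r′ D = rep-near {j = j} (record
      { off≗ = λ _ → refl ; off-j = upd-≡ (off I) j true
      ; rep≗ = λ e _ ne → trans (lookup∘update′ (ne ∘ sym) (rep I) r) (sym (lookup∘update′ (ne ∘ sym) (rep I) r′))
      ; shows = id ; shows⁻ = id })

    report-inner : ∀ I j r r′ D l s E → Near (pin (pin I j r D) l s E) (pin (pin I j r′ D) l s E) v
    report-inner I j r r′ D l s E = rep-near {j = j} (record
      { off≗ = λ _ → refl ; off-j = off-j
      ; rep≗ = rep≗
      ; shows = id ; shows⁻ = id })
      where
      off-j : upd (upd (off I) j true) l true j ≡ true
      off-j with l ≟ j
      ... | yes _ = refl
      ... | no _  = upd-≡ (off I) j true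
      rep≗ : ∀ e → upd (upd (off I) j true) l true e ≡ true → j ≢ e →
             lookup ((rep I [ j ]≔ r) [ l ]≔ s) e ≡ lookup ((rep I [ j ]≔ r′) [ l ]≔ s) e
      rep≗ e _ ne with l ≟ e
      ... | yes refl = trans (lookup∘update l (rep I [ j ]≔ r) s) (sym (lookup∘update l (rep I [ j ]≔ r′) s))
      ... | no l≢e   = trans (trans (lookup∘update′ (l≢e ∘ sym) (rep I [ j ]≔ r) s) (lookup∘update′ (ne ∘ sym) (rep I) r))
              (sym (trans (lookup∘update′ (l≢e ∘ sym) (rep I [ j ]≔ r′) s) (lookup∘update′ (ne ∘ sym) (rep I) r′)))

    -- It is enough to measure `X`, because `Differ` forces `Y` to have the same free edges.
    Claim : ℕ → Set
    Claim N = ∀ {X Y u a b} → active (off X) < N → Differ X Y u a b → Near X Y F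

    module Step {N} (rec : Claim N) {X Y u a b} (lt : active (off X) < suc N) (D : Differ X Y u a b) where
      open Differ D
      open Pinned-pairs D

      lt-pin : ∀ {j} → off X j ≡ false → active (upd (off X) j true) < N
      lt-pin {j} oj = <-≤-trans (active-mark (off X) j oj) (s≤s⁻¹ lt)

      same-near : ∀ {j} → ActiveAt X u j → Near (pin X j b (λ _ → b)) (pin Y j a (λ _ → a)) (v + F)
      same-near {j} (oj , ij) with other-end G ij
      ... | w , u≢w , iw , only = Near-trans (report X j b a (λ _ → b)) (rec (lt-pin oj) (Differ-same oj ij iw only))

      onto-near : ∀ {j} c → ActiveAt X u j → Near (pin X j b (λ _ → b)) (pin Y j c (λ _ → c)) (v + (F + F))
      onto-near {j} c (oj , ij) with other-end G ij
      ... | w , u≢w , iw , only = Near-trans (report X j b c (λ _ → b))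
        (Near-trans (rec (lt-pin oj) (Differ-tone X j c b c oj ij u≢w iw only))
                    (rec (lt-pin oj) (Differ-onto c oj ij u≢w iw only)))

      -- The summands in order: the reported colours of `j` and of `l`, the far end of `j`, the far
      -- end of `l`, and finally `c′` against `c` at `u`. All three half-edge changes have both `j`
      -- and `l` pinned.
      cross-near : ∀ {j l} c c′ → j ≢ l → ActiveAt X u j → ActiveAt X u l →
        Near (pin (pin X j b (λ _ → b)) l c′ (λ _ → c′)) (pin (pin Y l a (λ _ → a)) j c (λ _ → c)) (v + (v + (F + (F + F))))
      cross-near {j} {l} c c′ j≢l (oj , ij) (ol , il) with other-end G ij | other-end G il
      ... | w , u≢w , iw , only | w′ , u≢w′ , iw′ , only′ =
        Near-trans (report-inner X j b c (λ _ → b) l c′ (λ _ → c′))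
        (Near-trans (report (pin X j c (λ _ → b)) l c′ a (λ _ → c′))
        (Near-trans (rec lt₂ (Differ-pin l a (λ _ → c′) ol′ (Differ-tone X j c b c oj ij u≢w iw only)))
        (Near-trans (rec lt₂ (Differ-tone (pin X j c (twoTone u b c)) l a c′ a ol′ il u≢w′ iw′ only′))
                    (rec lt₂ (Differ-cross c c′ j≢l oj ol ij u≢w iw only il u≢w′ iw′ only′)))))
        where
        ol′ : upd (off X) j true l ≡ false
        ol′ = mark⁺ (off X) j≢l ol
        lt₂ : active (upd (upd (off X) j true) l true) < N
        lt₂ = <-trans (active-mark (upd (off X) j true) l ol′) (lt-pin oj)

      same-W : ∀ j → W (Part X u b j) (Part Y u a j) (v + F)
      same-W j with Part-cases X u b j | Part-cases Y u a j
      ... | inj₁ z | _      = W-zeroˡ {ν = Part Y u a j} z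
      ... | inj₂ _ | inj₁ z = W-zeroʳ {μ = Part X u b j} z
      ... | inj₂ (at , e) | inj₂ (_ , e′) = W-via e e′ (proj₁ (same-near at))

      -- The left part has only `j` pinned, the right one only `l`. Each is split by the colour of
      -- the missing edge; both edges are then pinned on either side, and every pair of pieces obeys
      -- the same bound.
      cross-W : ∀ j l → W (Part X u b j) (Part Y u a l) (2 * v + 3 * F)
      cross-W j l with j ≟ l
      -- `Matching` asks for all pairs; on the diagonal the cheaper `same-W` serves.
      ... | yes refl = W-mono {Part X u b j} {Part Y u a j} (≤-trans (m≤m+n (v + F) (v + 2 * F)) (≤-reflexive (alg v F))) (same-W j)
        where
        alg : ∀ v F → v + F + (v + 2 * F) ≡ 2 * v + 3 * F
        alg = solve-∀
      ... | no j≢l with Part-cases X u b j | Part-cases Y u a l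
      ...   | inj₁ z | _      = W-zeroˡ {ν = Part Y u a l} z
      ...   | inj₂ _ | inj₁ z = W-zeroʳ {μ = Part X u b j} z
      ...   | inj₂ (at@(oj , ij) , e) | inj₂ ((ol , il) , e′) = W-cong {μX} {Part X u b j} {μY} {Part Y u a l}
              (λ σ → sym (trans (e σ) (Fix-total X′ l σ))) (λ σ → sym (trans (e′ σ) (Fix-total Y′ j σ)))
              (W-∑ˡ (allFin q) {λ c′ → Fix X′ l c′} {μY} (λ c′ → W-∑ʳ (allFin q) {λ c → Fix Y′ j c} {Fix X′ l c′} (λ c → fixed c c′)))
        where
        X′ Y′ : Instance
        X′ = pin X j b (λ _ → b)
        Y′ = pin Y l a (λ _ → a)
        μX μY : Measure
        μX σ = ∑ (allFin q) (λ c → Fix X′ l c σ)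
        μY σ = ∑ (allFin q) (λ c → Fix Y′ j c σ)
        olX : off X l ≡ false
        olX = trans (off≗ l) ol
        alg : ∀ v F → v + (v + (F + (F + F))) ≡ 2 * v + 3 * F
        alg = solve-∀
        fixed : ∀ c c′ → W (Fix X′ l c′) (Fix Y′ j c) (2 * v + 3 * F)
        fixed c c′ with Fix-cases X′ l c′ (mark⁺ (off X) j≢l olX) | Fix-cases Y′ j c (mark⁺ (off Y) (j≢l ∘ sym) (offY oj))
        ... | inj₁ z | _      = W-zeroˡ {ν = Fix Y′ j c} z
        ... | inj₂ _ | inj₁ z = W-zeroʳ {μ = Fix X′ l c′} z
        ... | inj₂ h | inj₂ h′ = W-mono {Fix X′ l c′} {Fix Y′ j c} (≤-reflexive (alg v F))
                (W-via h h′ (proj₁ (cross-near c c′ j≢l at (olX , il))))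

      onto-W : ∀ j → W (Part X u b j) (χ Y) (v + 2 * F)
      onto-W j with Part-cases X u b j
      ... | inj₁ z = W-zeroˡ {ν = χ Y} z
      ... | inj₂ (at , e) = W-cong {Part X u b j} {Part X u b j} {μY} {χ Y} (λ _ → refl) (λ σ → sym (Fix-total Y j σ))
              (W-∑ʳ (allFin q) {λ c → Fix Y j c} {Part X u b j} fixed)
        where
        μY : Measure
        μY σ = ∑ (allFin q) (λ c → Fix Y j c σ)
        alg : ∀ v F → v + (F + F) ≡ v + 2 * F
        alg = solve-∀
        fixed : ∀ c → W (Part X u b j) (Fix Y j c) (v + 2 * F)
        fixed c with Fix-cases Y j c (offY (proj₁ at))
        ... | inj₁ z = W-zeroʳ {μ = Part X u b j} z
        ... | inj₂ h = W-mono {Part X u b j} {Fix Y j c} (≤-reflexive (alg v F)) (W-via e h (proj₁ (onto-near c at)))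

    -- `X` shows `a` at `u`, so its free edges there avoid `a` anyway. Once `b` is excluded as well,
    -- the condition is symmetric in `a` and `b`, and so the common part Z is the same set on both
    -- sides.
    Unused-Differ : ∀ {X Y u a b} → Differ X Y u a b → ∀ σ → Unused X u b σ → Unused Y u a σ
    Unused-Differ {X} {Y} {u} {a} {b} D σ (V , nob) =
      valid (λ e o → trans (pinned V e (back o)) (rep≗ e (back o)))
            (λ e o → listed V e (back o))
            (λ e f w o o′ → proper V e f w (back o) (back o′))
            avoid ,
      λ e (oe , ie) → avoids V e u a (back oe) ie has-a
      where
      open Differ D
      back : ∀ {e t} → off Y e ≡ t → off X e ≡ t
      back {e} = trans (off≗ e)
      avoid : ∀ e w x → off Y e ≡ false → Incident G e w → Shows Y w x → lookup σ e ≢ x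
      avoid e w x oe ie s with cov₂ s
      ... | inj₁ (refl , refl) = nob e (back oe , ie)
      ... | inj₂ s′            = avoids V e w x (back oe) ie s′

    Free-Differ : ∀ {X Y u a b} → Differ X Y u a b → ∀ σ → Free X u b σ ≡ Free Y u a σ
    Free-Differ {X} {Y} {u} {a} {b} D σ =
      ⟦⟧-cong (unused? X u b σ) (unused? Y u a σ) (Unused-Differ D σ) (Unused-Differ (Differ-sym D) σ)

    χ-mass : ∀ I u c → ∣ χ I ∣ₘ ≡ ∣ Free I u c ∣ₘ + ∑ (allFin m) (λ j → ∣ Part I u c j ∣ₘ)
    χ-mass I u c = trans (∑-cong (allColorings m q) (χ-split I u c))
      (trans (∑-+ (allColorings m q) (Free I u c) _)
             (cong (∣ Free I u c ∣ₘ +_) (∑-swap (allColorings m q) (allFin m) (λ σ j → Part I u c j σ))))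

    -- Since `β` is positive, an empty common part forces all parts to be empty. As X and Y share
    -- their common part, they are empty together, which gives the second component of `Near`;
    -- otherwise Z has the nonzero mass that `Matching` divides by.
    χ-empty : ∀ I u c → ∣ Free I u c ∣ₘ ≡ 0 → ∣ χ I ∣ₘ ≡ 0
    χ-empty I u c z = trans (χ-mass I u c) (cong₂ _+_ z (∑-0 (allFin m) (λ j →
      n≤0⇒n≡0 (*-cancelˡ-≤ β (≤-trans (Part≤Free I u c j) (≤-reflexive (trans z (sym (*-zeroʳ β)))))))))

    -- This is (z - x)(z - y) ≥ 0, with `s` and `t` as the two factors.
    product-cap : ∀ {x y z} → x ≤ z → y ≤ z → z * (x + y) ≤ z * z + x * y
    product-cap {x} {y} {z} x≤z y≤z = begin
      z * (x + y)                              ≡⟨ *-distribˡ-+ z x y ⟩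
      z * x + z * y                            ≡⟨ cong (λ t → t * x + z * y) (sym ez) ⟩
      (y + t) * x + z * y                      ≡⟨ cong (λ t′ → (y + t) * x + t′ * y) (sym ex) ⟩
      (y + t) * x + (x + s) * y                ≤⟨ m≤m+n _ (s * t) ⟩
      (y + t) * x + (x + s) * y + s * t        ≡⟨ alg x y s t ⟩
      (x + s) * (y + t) + x * y                ≡⟨ cong₂ (λ p r → p * r + x * y) ex ez ⟩
      z * z + x * y ∎
      where
      open ≤-Reasoning
      s t : ℕ
      s = z ∸ x
      t = z ∸ y
      ex : x + s ≡ z
      ex = m+[n∸m]≡n x≤z
      ez : y + t ≡ z
      ez = m+[n∸m]≡n y≤z
      alg : ∀ x y s t → (y + t) * x + (x + s) * y + s * t ≡ (x + s) * (y + t) + x * y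
      alg = solve-∀

    step-W : ∀ {N} → Claim N → ∀ {X Y u a b} → active (off X) < suc N → Differ X Y u a b →
      NonZero ∣ Free X u b ∣ₘ → ∑ (allFin m) (λ j → ∣ Part Y u a j ∣ₘ) ≤ ∑ (allFin m) (λ j → ∣ Part X u b j ∣ₘ) →
      W (χ X) (χ Y) F
    step-W rec {X} {Y} {u} {a} {b} lt D nz A≤B = W-cong {M.μ} {χ X} {M.ν} {χ Y} (λ σ → sym (χ-split X u b σ)) (λ σ → sym (ν≡ σ))
      (M.matching capB capA caps count-active Δ≤ A≤B same-W cross-W
        (λ j → W-cong {Part X u b j} {Part X u b j} {χ Y} {M.ν} (λ _ → refl) ν≡ (onto-W j)))
      where
      open Step rec lt D
      open Differ D
      -- Edges that are pinned or miss `u` have empty parts, so only the free edges at `u`, at most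
      -- Δ of them, count towards the bound.
      g : Fin m → ℕ
      g j = ⟦ activeAt? X u j ⟧
      module M = Matching (allFin m) (Free X u b) (Part X u b) (Part Y u a) β F v Δ g {{nz}}
      free≡ : ∀ σ → Free X u b σ ≡ Free Y u a σ
      free≡ = Free-Differ D
      ν≡ : ∀ σ → χ Y σ ≡ M.ν σ
      ν≡ σ = trans (χ-split Y u a σ) (cong (_+ ∑ (allFin m) (λ j → Part Y u a j σ)) (sym (free≡ σ)))
      capB : ∀ j → β * ∣ Part X u b j ∣ₘ ≤ ∣ Free X u b ∣ₘ
      capB = Part≤Free X u b
      capA : ∀ j → β * ∣ Part Y u a j ∣ₘ ≤ ∣ Free X u b ∣ₘ
      capA j = ≤-trans (Part≤Free Y u a j) (≤-reflexive (sym (∑-cong (allColorings m q) free≡)))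
      caps : ∀ j → ∣ Free X u b ∣ₘ * (β * ∣ Part X u b j ∣ₘ + β * ∣ Part Y u a j ∣ₘ)
               ≤ g j * (∣ Free X u b ∣ₘ * ∣ Free X u b ∣ₘ) + β * ∣ Part X u b j ∣ₘ * (β * ∣ Part Y u a j ∣ₘ)
      caps j = go (activeAt? X u j)
        where
        z = ∣ Free X u b ∣ₘ
        go : (p : Dec (ActiveAt X u j)) → z * (β * ∣ Part X u b j ∣ₘ + β * ∣ Part Y u a j ∣ₘ)
               ≤ ⟦ p ⟧ * (z * z) + β * ∣ Part X u b j ∣ₘ * (β * ∣ Part Y u a j ∣ₘ)
        go (yes _) = ≤-trans (product-cap (capB j) (capA j)) (≤-reflexive (cong (_+ β * ∣ Part X u b j ∣ₘ * (β * ∣ Part Y u a j ∣ₘ)) (sym (*-identityˡ (z * z)))))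
        go (no ¬at) = ≤-trans (≤-reflexive (trans
            (cong₂ (λ s t → z * (β * s + β * t)) (Part-inactive X u b j ¬at)
               (Part-inactive Y u a j (λ (o , i) → ¬at (trans (off≗ j) o , i))))
            (trans (cong (z *_) (cong₂ _+_ (*-zeroʳ β) (*-zeroʳ β))) (*-zeroʳ z)))) z≤n
      count-active : ∑ (allFin m) g ≤ Δ
      count-active = ≤-trans (∑-mono (allFin m) (λ j → ⟦⟧-mono (activeAt? X u j) (incident? G j u) proj₂))
        (≤-trans (≤-reflexive (sym (length-filter (λ e → incident? G e u) (allFin m)))) (maxdeg u))

    claim : ∀ N → Claim N
    -- The bound 0 leaves no case. No base case is needed either: without free edges at `u` all
    -- parts are empty, and Z is matched to itself.
    claim (suc N) {X} {Y} {u} {a} {b} lt D = near , nonempty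
      where
      open Differ D
      free≡ : ∣ Free X u b ∣ₘ ≡ ∣ Free Y u a ∣ₘ
      free≡ = ∑-cong (allColorings m q) (Free-Differ D)
      nonempty : ∣ χ Y ∣ₘ ≡ 0 → ∣ χ X ∣ₘ ≡ 0
      nonempty z = χ-empty X u b (trans free≡ (m+n≡0⇒m≡0 _ (trans (sym (χ-mass Y u a)) z)))
      near : W (χ X) (χ Y) F
      near with ≡0⊎NonZero ∣ Free X u b ∣ₘ
      ... | inj₁ z  = W-zeroˡ {ν = χ Y} (χ-empty X u b z)
      ... | inj₂ nz with ≤-total (∑ (allFin m) (λ j → ∣ Part Y u a j ∣ₘ)) (∑ (allFin m) (λ j → ∣ Part X u b j ∣ₘ))
      ...   | inj₁ A≤B = step-W (claim N) lt D nz A≤B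
      ...   | inj₂ B≤A = W-sym {μ = χ Y} (step-W (claim N) lt′ (Differ-sym D) (subst NonZero free≡ nz) B≤A)
        where
        lt′ : active (off Y) < suc N
        lt′ = ≤-trans (≤-reflexive (cong suc (∑-cong (allFin m) (λ e → cong (λ t → ⟦ t Bool.≟ false ⟧) (sym (off≗ e)))))) lt

    half-edge : ∀ {X Y u a b} → Differ X Y u a b → Near X Y F
    half-edge {X} = claim (suc (active (off X))) ≤-refl

-- Natural numbers as rationals, and clearing the denominator of ε.

module Fractions where

  open Coupled using (∑)
  open import Data.Nat as ℕ using (ℕ; zero; suc; NonZero)
  import Data.Nat.Properties as ℕ
  open import Data.Integer as ℤ using (+_)
  open import Data.Rational as ℚ using (ℚ; mkℚ; 1ℚ; _+_; _*_; _≤_; _/_; 1/_; toℚᵘ; Positive; NonNegative)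

  ι : ℕ → ℚ
  ι k = + k / 1

  toℚᵘ-ι : ∀ k → toℚᵘ (ι k) ℚᵘ.≃ mkℚᵘ (+ k) 0
  toℚᵘ-ι k = ℚ.toℚᵘ-fromℚᵘ (mkℚᵘ (+ k) 0)

  ι-+ : ∀ a b → ι (a ℕ.+ b) ≡ ι a + ι b
  ι-+ a b = ℚ.toℚᵘ-injective (begin
    toℚᵘ (ι (a ℕ.+ b))             ≈⟨ toℚᵘ-ι (a ℕ.+ b) ⟩
    mkℚᵘ (+ (a ℕ.+ b)) 0           ≈⟨ *≡* (cong (ℤ._* + 1) (sym (cong₂ ℤ._+_ (ℤ.*-identityʳ (+ a)) (ℤ.*-identityʳ (+ b))))) ⟩
    mkℚᵘ (+ a) 0 ℚᵘ.+ mkℚᵘ (+ b) 0 ≈⟨ ℚᵘ.+-cong (ℚᵘ.≃-sym (toℚᵘ-ι a)) (ℚᵘ.≃-sym (toℚᵘ-ι b)) ⟩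
    toℚᵘ (ι a) ℚᵘ.+ toℚᵘ (ι b)     ≈⟨ ℚᵘ.≃-sym (ℚ.toℚᵘ-homo-+ (ι a) (ι b)) ⟩
    toℚᵘ (ι a + ι b)               ∎)
    where open import Relation.Binary.Reasoning.Setoid ℚᵘ.≃-setoid

  ι-* : ∀ a b → ι (a ℕ.* b) ≡ ι a * ι b
  ι-* a b = ℚ.toℚᵘ-injective (begin
    toℚᵘ (ι (a ℕ.* b))             ≈⟨ toℚᵘ-ι (a ℕ.* b) ⟩
    mkℚᵘ (+ (a ℕ.* b)) 0           ≈⟨ *≡* (cong (ℤ._* + 1) (ℤ.pos-* a b)) ⟩
    mkℚᵘ (+ a) 0 ℚᵘ.* mkℚᵘ (+ b) 0 ≈⟨ ℚᵘ.*-cong (ℚᵘ.≃-sym (toℚᵘ-ι a)) (ℚᵘ.≃-sym (toℚᵘ-ι b)) ⟩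
    toℚᵘ (ι a) ℚᵘ.* toℚᵘ (ι b)     ≈⟨ ℚᵘ.≃-sym (ℚ.toℚᵘ-homo-* (ι a) (ι b)) ⟩
    toℚᵘ (ι a * ι b)               ∎)
    where open import Relation.Binary.Reasoning.Setoid ℚᵘ.≃-setoid

  ι-mono : ∀ {a b} → a ℕ.≤ b → ι a ≤ ι b
  ι-mono {a} {b} a≤b = ℚ.toℚᵘ-cancel-≤ (ℚᵘ.≤-respˡ-≃ (ℚᵘ.≃-sym (toℚᵘ-ι a)) (ℚᵘ.≤-respʳ-≃ (ℚᵘ.≃-sym (toℚᵘ-ι b))
    (*≤* (ℤ.*-monoʳ-≤-nonNeg (+ 1) (ℤ.+≤+ a≤b)))))

  ι-cancel : ∀ {a b} → ι a ≤ ι b → a ℕ.≤ b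
  ι-cancel {a} {b} h with ℚᵘ.≤-respˡ-≃ (toℚᵘ-ι a) (ℚᵘ.≤-respʳ-≃ (toℚᵘ-ι b) (ℚ.toℚᵘ-mono-≤ h))
  ... | *≤* p = ℤ.drop‿+≤+ (subst₂ ℤ._≤_ (ℤ.*-identityʳ (+ a)) (ℤ.*-identityʳ (+ b)) p)

  ι-nonNeg : ∀ k → NonNegative (ι k)
  ι-nonNeg k = ℚ.normalize-nonNeg k 1

  ι-pos : ∀ k → .{{NonZero k}} → Positive (ι k)
  ι-pos k = ℚ.normalize-pos k 1

  ι-inv : ∀ k → .{{NonZero k}} → ι k * inv k ≡ 1ℚ
  ι-inv (suc k) = ℚ.toℚᵘ-injective (begin
    toℚᵘ (ι (suc k) * inv (suc k))         ≈⟨ ℚ.toℚᵘ-homo-* (ι (suc k)) (inv (suc k)) ⟩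
    toℚᵘ (ι (suc k)) ℚᵘ.* toℚᵘ (inv (suc k)) ≈⟨ ℚᵘ.*-cong (toℚᵘ-ι (suc k)) (ℚ.toℚᵘ-fromℚᵘ (mkℚᵘ (+ 1) k)) ⟩
    mkℚᵘ (+ suc k) 0 ℚᵘ.* mkℚᵘ (+ 1) k     ≈⟨ *≡* (trans (ℤ.*-identityʳ (+ suc k ℤ.* + 1))
        (trans (ℤ.*-comm (+ suc k) (+ 1)) (cong (λ t → + 1 ℤ.* + t) (sym (ℕ.*-identityˡ (suc k)))))) ⟩
    toℚᵘ 1ℚ ∎)
    where open import Relation.Binary.Reasoning.Setoid ℚᵘ.≃-setoid

  inv-nonNeg : ∀ k → NonNegative (inv k)
  inv-nonNeg zero    = _
  inv-nonNeg (suc k) = ℚ.normalize-nonNeg 1 (suc k)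

  -- If k = 0, both sides are 0 because inv 0 = 0.
  ι-inv-cancel : ∀ k s x → (k ≡ 0 → s ≡ 0) → ι (k ℕ.* x) * inv (k ℕ.* s) ≡ ι x * inv s
  ι-inv-cancel zero s x h rewrite h refl = trans (ℚ.*-zeroʳ (ι 0)) (sym (ℚ.*-zeroʳ (ι x)))
  ι-inv-cancel (suc k) zero x h rewrite ℕ.*-zeroʳ k = trans (ℚ.*-zeroʳ (ι (suc k ℕ.* x))) (sym (ℚ.*-zeroʳ (ι x)))
  ι-inv-cancel K@(suc k) S@(suc s) x h = begin
    ι (K ℕ.* x) * inv (K ℕ.* S)                    ≡⟨ cong (_* inv (K ℕ.* S)) (ι-* K x) ⟩
    ι K * ι x * inv (K ℕ.* S)                      ≡⟨ sym (ℚ.*-identityʳ _) ⟩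
    ι K * ι x * inv (K ℕ.* S) * 1ℚ                 ≡⟨ cong (ι K * ι x * inv (K ℕ.* S) *_) (sym (ι-inv S)) ⟩
    ι K * ι x * inv (K ℕ.* S) * (ι S * inv S)      ≡⟨ solve 5 (λ a b c d e → (a :* b) :* c :* (d :* e) := ((a :* d) :* c) :* (b :* e)) refl
                                                         (ι K) (ι x) (inv (K ℕ.* S)) (ι S) (inv S) ⟩
    ι K * ι S * inv (K ℕ.* S) * (ι x * inv S)      ≡⟨ cong (λ t → t * inv (K ℕ.* S) * (ι x * inv S)) (sym (ι-* K S)) ⟩
    ι (K ℕ.* S) * inv (K ℕ.* S) * (ι x * inv S)    ≡⟨ cong (_* (ι x * inv S)) (ι-inv (K ℕ.* S)) ⟩
    1ℚ * (ι x * inv S)                             ≡⟨ ℚ.*-identityˡ _ ⟩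
    ι x * inv S                                    ∎
    where
    open ≡-Reasoning
    open +-*-Solver

  ι-inv≤ : ∀ M k → ι (M ℕ.* k) * inv M ≤ ι k
  ι-inv≤ zero k = ℚ.≤-trans (ℚ.≤-reflexive (ℚ.*-zeroʳ (ι 0))) (ℚ.nonNegative⁻¹ (ι k) {{ι-nonNeg k}})
  ι-inv≤ M@(suc _) k = ℚ.≤-reflexive (begin
    ι (M ℕ.* k) * inv M   ≡⟨ cong (_* inv M) (trans (ι-* M k) (ℚ.*-comm (ι M) (ι k))) ⟩
    ι k * ι M * inv M     ≡⟨ ℚ.*-assoc (ι k) (ι M) (inv M) ⟩
    ι k * (ι M * inv M)   ≡⟨ cong (ι k *_) (ι-inv M) ⟩
    ι k * 1ℚ              ≡⟨ ℚ.*-identityʳ (ι k) ⟩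
    ι k                   ∎)
    where open ≡-Reasoning

  sumℚ-ι : ∀ {A : Set} (xs : List A) (f : A → ℚ) (g : A → ℕ) r → (∀ x → f x ≡ ι (g x) * r) →
           sumℚ (List.map f xs) ≡ ι (∑ xs g) * r
  sumℚ-ι []       f g r h = sym (ℚ.*-zeroˡ r)
  sumℚ-ι (x ∷ xs) f g r h = begin
    f x + sumℚ (List.map f xs)        ≡⟨ cong₂ _+_ (h x) (sumℚ-ι xs f g r h) ⟩
    ι (g x) * r + ι (∑ xs g) * r      ≡⟨ sym (ℚ.*-distribʳ-+ r (ι (g x)) (ι (∑ xs g))) ⟩
    (ι (g x) + ι (∑ xs g)) * r        ≡⟨ cong (_* r) (sym (ι-+ (g x) (∑ xs g))) ⟩
    ι (g x ℕ.+ ∑ xs g) * r            ∎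
    where open ≡-Reasoning

  module _ (ε : ℚ) .{{ε>0 : Positive ε}} (v F : ℕ) (Fε : ι F * ε ≡ ι v) where
    private
      instance
        ε≢0 : ℚ.NonZero ε
        ε≢0 = ℚ.pos⇒nonZero ε

    scaled-bound : ι v * (1ℚ + (+ 2 / 1) * (1/ ε) {{ℚ.pos⇒nonZero ε}}) ≡ ι (v ℕ.+ 2 ℕ.* F)
    scaled-bound = begin
      ι v * (1ℚ + ι 2 * 1/ ε)               ≡⟨ solve 3 (λ v t e → v :* (con 1ℚ :+ t :* e) := v :+ t :* (v :* e)) refl (ι v) (ι 2) (1/ ε) ⟩
      ι v + ι 2 * (ι v * 1/ ε)              ≡⟨ cong (λ t → ι v + ι 2 * (t * 1/ ε)) (sym Fε) ⟩
      ι v + ι 2 * (ι F * ε * 1/ ε)          ≡⟨ cong (λ t → ι v + ι 2 * t) (trans (ℚ.*-assoc (ι F) ε (1/ ε))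
                                                 (trans (cong (ι F *_) (ℚ.*-inverseʳ ε)) (ℚ.*-identityʳ (ι F)))) ⟩
      ι v + ι 2 * ι F                       ≡⟨ cong (λ t → ι v + t) (sym (ι-* 2 F)) ⟩
      ι v + ι (2 ℕ.* F)                     ≡⟨ sym (ι-+ v (2 ℕ.* F)) ⟩
      ι (v ℕ.+ 2 ℕ.* F)                     ∎
      where
      open ≡-Reasoning
      open +-*-Solver

    -- Multiplication by `F` turns ε into the integer `v`, so the rational list bound becomes one
    -- between natural numbers.
    cleared : ∀ e Δ l → ι e + ((1ℚ + ε) * ι Δ + 1ℚ) ≤ ι l → F ℕ.* e ℕ.+ (Δ ℕ.* (v ℕ.+ F) ℕ.+ F) ℕ.≤ F ℕ.* l
    cleared e Δ l h = ι-cancel (subst₂ _≤_ lhs (sym (ι-* F l)) (ℚ.*-monoˡ-≤-nonNeg (ι F) {{ι-nonNeg F}} h))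
      where
      open ≡-Reasoning
      open +-*-Solver
      lhs : ι F * (ι e + ((1ℚ + ε) * ι Δ + 1ℚ)) ≡ ι (F ℕ.* e ℕ.+ (Δ ℕ.* (v ℕ.+ F) ℕ.+ F))
      lhs = begin
        ι F * (ι e + ((1ℚ + ε) * ι Δ + 1ℚ))
          ≡⟨ solve 4 (λ F e ε Δ → F :* (e :+ ((con 1ℚ :+ ε) :* Δ :+ con 1ℚ)) := F :* e :+ (Δ :* (F :* ε :+ F) :+ F)) refl (ι F) (ι e) ε (ι Δ) ⟩
        ι F * ι e + (ι Δ * (ι F * ε + ι F) + ι F)
          ≡⟨ cong (λ t → ι F * ι e + (ι Δ * (t + ι F) + ι F)) Fε ⟩
        ι F * ι e + (ι Δ * (ι v + ι F) + ι F)
          ≡⟨ cong₂ (λ s t → s + (t + ι F)) (sym (ι-* F e)) (trans (cong (ι Δ *_) (sym (ι-+ v F))) (sym (ι-* Δ (v ℕ.+ F)))) ⟩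
        ι (F ℕ.* e) + (ι (Δ ℕ.* (v ℕ.+ F)) + ι F)
          ≡⟨ trans (cong (λ t → ι (F ℕ.* e) + t) (sym (ι-+ (Δ ℕ.* (v ℕ.+ F)) F))) (sym (ι-+ (F ℕ.* e) (Δ ℕ.* (v ℕ.+ F) ℕ.+ F))) ⟩
        ι (F ℕ.* e ℕ.+ (Δ ℕ.* (v ℕ.+ F) ℕ.+ F)) ∎

  ι-denominator : ∀ n d .(c : Coprime n (suc d)) → ι (suc d) * mkℚ (+ n) d c ≡ ι n
  ι-denominator n d c = ℚ.toℚᵘ-injective (begin
    toℚᵘ (ι (suc d) * mkℚ (+ n) d c)       ≈⟨ ℚ.toℚᵘ-homo-* (ι (suc d)) (mkℚ (+ n) d c) ⟩
    toℚᵘ (ι (suc d)) ℚᵘ.* mkℚᵘ (+ n) d     ≈⟨ ℚᵘ.*-congʳ (toℚᵘ-ι (suc d)) ⟩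
    mkℚᵘ (+ suc d) 0 ℚᵘ.* mkℚᵘ (+ n) d     ≈⟨ *≡* (trans (ℤ.*-identityʳ (+ suc d ℤ.* + n))
        (trans (ℤ.*-comm (+ suc d) (+ n)) (cong (λ t → + n ℤ.* + t) (sym (ℕ.*-identityˡ (suc d)))))) ⟩
    mkℚᵘ (+ n) 0                           ≈⟨ ℚᵘ.≃-sym (toℚᵘ-ι n) ⟩
    toℚᵘ (ι n)                             ∎)
    where open import Relation.Binary.Reasoning.Setoid ℚᵘ.≃-setoid

-- From integer plans to rational couplings, and the choice of constants.

module Conclusion where

  open import Data.Nat using (ℕ; suc; _+_; _*_; _≤_; _<_; z≤n; s≤s; s≤s⁻¹; NonZero; >-nonZero)
  open import Data.Nat.Properties hiding (_≟_; suc-injective)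
  open import Data.Nat.DivMod using (_/_; _%_; m≡m%n+[m/n]*n; m%n<n)
  open import Data.Rational as ℚ using (ℚ; 1ℚ; 1/_; Positive)
  open Coupled
  open Fractions
  open import Data.Nat.Tactic.RingSolver using (solve-∀)

  uniformOn-ι : ∀ {m q} {P : Pred (Coloring m q) 0ℓ} (P? : Decidable P) σ →
                uniformOn P? σ ≡ ι ⟦ P? σ ⟧ ℚ.* inv (∑ᶜ (λ σ → ⟦ P? σ ⟧))
  uniformOn-ι {m} {q} P? σ with P? σ
  ... | yes _ = trans (cong inv (length-filter P? (allColorings m q))) (sym (ℚ.*-identityˡ _))
  ... | no _  = sym (ℚ.*-zeroˡ (inv (∑ᶜ (λ σ → ⟦ P? σ ⟧))))

  module Pinning {n m q : ℕ} (G : Graph n m) (L : Fin m → Subset q) (v : ℕ) where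
    open HalfEdge G L v

    -- The original problem. The colour `z` fills fields that are never read, because no edge is
    -- off.
    blank : Fin q → Instance
    blank z = record { off = λ _ → false ; rep = Vec.replicate m z ; dart = λ _ _ → z }

    pinnedOnly : Fin q → Fin m → Fin q → Instance
    pinnedOnly z i c = pin (blank z) i c (λ _ → c)

    χ-pinned : ∀ z i c → c ∈ L i → ∀ σ → ⟦ pinned? G L i c σ ⟧ ≡ χ (pinnedOnly z i c) σ
    χ-pinned z i c c∈L σ = trans
      (⟦⟧-cong (pinned? G L i c σ) (valid? (blank z) σ ×-dec (lookup σ i ≟ c)) (λ (P , e) → to P , e) (λ (V , e) → from V , e))
      (Fix≡pin (blank z) i c refl c∈L (λ { _ _ _ (_ , () , _) }) σ)
      where
      to : Proper G L σ → Valid (blank z) σ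
      to (l , p) = valid (λ _ ()) (λ e _ → l e) (λ e f w _ _ ne ew fw → p e f (adjacent G ne ew fw)) (λ { _ _ _ _ _ (_ , () , _) })
      from : Valid (blank z) σ → Proper G L σ
      from V = (λ e → listed V e refl) ,
        λ { e f (ne , inj₁ fw) → proper V e f _ refl refl ne (inj₁ refl) fw
          ; e f (ne , inj₂ fw) → proper V e f _ refl refl ne (inj₂ refl) fw }

    -- The second half of a recolouring, for the edge pinned at the very start: here `u` carries no
    -- other discrepancy to merge with.
    Differ-untone : ∀ X j r {u w} b c → off X j ≡ false → Incident G j u → u ≢ w → Incident G j w →
                    (∀ x → Incident G j x → x ≡ u ⊎ x ≡ w) →
                    Differ (pin X j r (twoTone u b c)) (pin X j r (λ _ → c)) u b c
    Differ-untone X j r {u} {w} b c oj iu u≢w iw only = record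
      { off≗ = λ _ → refl ; rep≗ = λ _ _ → refl
      ; has-a = subst (Shows M u) (twoTone-≡ u b c) (shows-new X j r (twoTone u b c) iu)
      ; has-b = shows-new X j r (λ _ → c) iu
      ; cov₁ = λ s → [ from₁ , inj₂ ∘ shows-old X j r (λ _ → c) oj ]′ (shows-pin⁻ X j r (twoTone u b c) s)
      ; cov₂ = λ s → [ from₂ , inj₂ ∘ shows-old X j r (twoTone u b c) oj ]′ (shows-pin⁻ X j r (λ _ → c) s) }
      where
      M N : Instance
      M = pin X j r (twoTone u b c)
      N = pin X j r (λ _ → c)
      from₁ : ∀ {w′ x} → Incident G j w′ × twoTone u b c w′ ≡ x → (w′ ≡ u × x ≡ b) ⊎ Shows N w′ x
      from₁ (ij , refl) with only _ ij
      ... | inj₁ refl = inj₁ (refl , twoTone-≡ u b c)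
      ... | inj₂ refl = inj₂ (subst (Shows N w) (sym (twoTone-≢ b c u≢w)) (shows-new X j r (λ _ → c) iw))
      from₂ : ∀ {w′ x} → Incident G j w′ × c ≡ x → (w′ ≡ u × x ≡ c) ⊎ Shows M w′ x
      from₂ (ij , refl) with only _ ij
      ... | inj₁ refl = inj₁ (refl , refl)
      ... | inj₂ refl = inj₂ (subst (Shows M w) (twoTone-≢ b c u≢w) (shows-new X j r (twoTone u b c) iw))

    -- The plan is divided by its total mass. The hypotheses on zero masses cover the degenerate
    -- case: if one measure is 0, so is the other, and `inv 0` = 0 makes the coupling and both of
    -- its marginals 0.
    W⇒W₁ : ∀ {μ ν : Measure} {K} {p r : Coloring m q → ℚ} {k} → W μ ν K →
           (∣ μ ∣ₘ ≡ 0 → ∣ ν ∣ₘ ≡ 0) → (∣ ν ∣ₘ ≡ 0 → ∣ μ ∣ₘ ≡ 0) →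
           (∀ σ → p σ ≡ ι (μ σ) ℚ.* inv ∣ μ ∣ₘ) → (∀ σ → r σ ≡ ι (ν σ) ℚ.* inv ∣ ν ∣ₘ) →
           .{{NonZero v}} → ι v ℚ.* k ≡ ι K → W₁≤ p r k
    W⇒W₁ {μ} {ν} {K} {p} {r} {k} w μ0⇒ν0 ν0⇒μ0 p≡ r≡ vk = ωℚ , record { nonneg = nonneg ; marg₁ = marg₁ ; marg₂ = marg₂ } , cost≤k
      where
      open T w renaming (n to N; n≢0 to N≢0)
      cs = allColorings m q
      M : ℕ
      M = N * (∣ μ ∣ₘ * ∣ ν ∣ₘ)
      ωℚ : Coloring m q → Coloring m q → ℚ
      ωℚ σ τ = ι (ω σ τ) ℚ.* inv M
      nonneg : ∀ σ τ → ℚ.0ℚ ℚ.≤ ωℚ σ τ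
      nonneg σ τ = ℚ.≤-trans (ℚ.≤-reflexive (sym (ℚ.*-zeroˡ (inv M))))
        (ℚ.*-monoʳ-≤-nonNeg (inv M) {{inv-nonNeg M}} (ℚ.nonNegative⁻¹ (ι (ω σ τ)) {{ι-nonNeg (ω σ τ)}}))
      N*0 : ∀ {s} → N * s ≡ 0 → s ≡ 0
      N*0 {s} e = *-cancelˡ-≡ s 0 N (trans e (sym (*-zeroʳ N)))
      alg₁ : ∀ n a b → n * (a * b) ≡ n * b * a
      alg₁ = solve-∀
      alg₂ : ∀ n a b → n * (a * b) ≡ n * a * b
      alg₂ = solve-∀
      marg₁ : ∀ σ → sumℚ (List.map (ωℚ σ) cs) ≡ p σ
      marg₁ σ = begin
        sumℚ (List.map (ωℚ σ) cs)                                ≡⟨ sumℚ-ι cs (ωℚ σ) (ω σ) (inv M) (λ _ → refl) ⟩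
        ι (∑ cs (ω σ)) ℚ.* inv M                                 ≡⟨ cong₂ (λ s t → ι s ℚ.* inv t) (trans (row σ) (alg₂ N ∣ ν ∣ₘ (μ σ))) (alg₁ N ∣ μ ∣ₘ ∣ ν ∣ₘ) ⟩
        ι (N * ∣ ν ∣ₘ * μ σ) ℚ.* inv (N * ∣ ν ∣ₘ * ∣ μ ∣ₘ)       ≡⟨ ι-inv-cancel (N * ∣ ν ∣ₘ) ∣ μ ∣ₘ (μ σ) (ν0⇒μ0 ∘ N*0) ⟩
        ι (μ σ) ℚ.* inv ∣ μ ∣ₘ                                   ≡⟨ sym (p≡ σ) ⟩
        p σ                                                      ∎
        where open ≡-Reasoning
      marg₂ : ∀ τ → sumℚ (List.map (λ σ → ωℚ σ τ) cs) ≡ r τ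
      marg₂ τ = begin
        sumℚ (List.map (λ σ → ωℚ σ τ) cs)                        ≡⟨ sumℚ-ι cs (λ σ → ωℚ σ τ) (λ σ → ω σ τ) (inv M) (λ _ → refl) ⟩
        ι (∑ cs (λ σ → ω σ τ)) ℚ.* inv M                         ≡⟨ cong₂ (λ s t → ι s ℚ.* inv t) (trans (col τ) (alg₂ N ∣ μ ∣ₘ (ν τ))) (alg₂ N ∣ μ ∣ₘ ∣ ν ∣ₘ) ⟩
        ι (N * ∣ μ ∣ₘ * ν τ) ℚ.* inv (N * ∣ μ ∣ₘ * ∣ ν ∣ₘ)       ≡⟨ ι-inv-cancel (N * ∣ μ ∣ₘ) ∣ ν ∣ₘ (ν τ) (μ0⇒ν0 ∘ N*0) ⟩
        ι (ν τ) ℚ.* inv ∣ ν ∣ₘ                                   ≡⟨ sym (r≡ τ) ⟩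
        r τ                                                      ∎
        where open ≡-Reasoning
      hamming≡ : ∀ σ τ → hamming σ τ ≡ ham σ τ
      hamming≡ σ τ = length-filter (λ e → ¬? (lookup σ e ≟ lookup τ e)) (allFin m)
      C : ℕ
      C = ∑ cs (λ σ → ∑ cs (λ τ → ω σ τ * ham σ τ))
      costℚ : cost ωℚ ≡ ι C ℚ.* inv M
      costℚ = sumℚ-ι cs _ (λ σ → ∑ cs (λ τ → ω σ τ * ham σ τ)) (inv M) (λ σ →
        sumℚ-ι cs _ (λ τ → ω σ τ * ham σ τ) (inv M) (λ τ → trans (cong (λ h → ωℚ σ τ ℚ.* ι h) (hamming≡ σ τ))
          (trans (S.solve 3 (λ a b c → (a S.:* b) S.:* c S.:= (a S.:* c) S.:* b) refl (ι (ω σ τ)) (inv M) (ι (ham σ τ)))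
                 (cong (ℚ._* inv M) (sym (ι-* (ω σ τ) (ham σ τ)))))))
        where module S = +-*-Solver
      vC : v * C ≡ planCost ω
      vC = trans (sym (∑-*ˡ cs v _)) (∑-cong cs (λ σ → trans (sym (∑-*ˡ cs v _)) (∑-cong cs (λ τ → swap v (ω σ τ) (ham σ τ)))))
        where
        swap : ∀ v a b → v * (a * b) ≡ a * (v * b)
        swap = solve-∀
      bound : ι (v * C) ℚ.* inv M ℚ.≤ ι K
      bound = ℚ.≤-trans (ℚ.*-monoʳ-≤-nonNeg (inv M) {{inv-nonNeg M}}
          (ι-mono (≤-trans (≤-reflexive vC) (≤-trans cost≤ (≤-reflexive (sym (*-assoc N (∣ μ ∣ₘ * ∣ ν ∣ₘ) K)))))))
        (ι-inv≤ M K)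
      cost≤k : cost ωℚ ℚ.≤ k
      cost≤k = ℚ.*-cancelˡ-≤-pos (ι v) {{ι-pos v}} (begin
        ι v ℚ.* cost ωℚ          ≡⟨ cong (ι v ℚ.*_) costℚ ⟩
        ι v ℚ.* (ι C ℚ.* inv M)       ≡⟨ sym (ℚ.*-assoc (ι v) (ι C) (inv M)) ⟩
        ι v ℚ.* ι C ℚ.* inv M         ≡⟨ cong (ℚ._* inv M) (sym (ι-* v C)) ⟩
        ι (v * C) ℚ.* inv M           ≤⟨ bound ⟩
        ι K                           ≡⟨ sym vk ⟩
        ι v ℚ.* k                     ∎)
        where open ℚ.≤-Reasoning

  module _ {n m q : ℕ} (G : Graph n m) (L : Fin m → Subset q) (v β F Δ : ℕ) {{_ : NonZero β}}
    (wide : ∀ e → edeg G e + suc β ≤ ∣ L e ∣) (maxdeg : MaxDegreeAtMost G Δ) (Δ≤ : Δ * (v + F) ≤ β * F) where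
    open Recursion G L v β F Δ wide maxdeg Δ≤
    open HalfEdge G L v
    open Pinning G L v

    pinned-near : ∀ z i a b → Near (pinnedOnly z i a) (pinnedOnly z i b) (v + (F + F))
    pinned-near z i a b with other-end G {i} (inj₁ refl)
    ... | w , u≢w , iw , only = Near-trans (report (blank z) i a b (λ _ → a))
      (Near-trans (half-edge (Differ-tone (blank z) i b a b refl (inj₁ refl) u≢w iw only))
                  (half-edge (Differ-untone (blank z) i b a b refl (inj₁ refl) u≢w iw only)))

    pinned-W₁ : .{{NonZero v}} → ∀ {k} → ι v ℚ.* k ≡ ι (v + 2 * F) →
                ∀ i a b → a ∈ L i → b ∈ L i → W₁≤ (μpin G L i a) (μpin G L i b) k
    pinned-W₁ {k} vk i a b a∈ b∈ =
      W⇒W₁ {μ} {ν} (W-cong {χ A} {μ} {χ B} {ν} (λ σ → sym (eA σ)) (λ σ → sym (eB σ)) (proj₁ (pinned-near a i a b)))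
        (λ z → trans ν≡ (proj₂ (pinned-near a i b a) (trans (sym μ≡) z)))
        (λ z → trans μ≡ (proj₂ (pinned-near a i a b) (trans (sym ν≡) z)))
        (uniformOn-ι (pinned? G L i a)) (uniformOn-ι (pinned? G L i b))
        (trans vk (cong ι (alg v F)))
      where
      A B : Instance
      A = pinnedOnly a i a
      B = pinnedOnly a i b
      μ ν : Measure
      μ σ = ⟦ pinned? G L i a σ ⟧
      ν σ = ⟦ pinned? G L i b σ ⟧
      eA : ∀ σ → μ σ ≡ χ A σ
      eA = χ-pinned a i a a∈
      eB : ∀ σ → ν σ ≡ χ B σ
      eB = χ-pinned a i b b∈
      μ≡ : ∣ μ ∣ₘ ≡ ∣ χ A ∣ₘ
      μ≡ = ∑-cong (allColorings m q) eA
      ν≡ : ∣ ν ∣ₘ ≡ ∣ χ B ∣ₘ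
      ν≡ = ∑-cong (allColorings m q) eB
      alg : ∀ v F → v + 2 * F ≡ v + (F + F)
      alg = solve-∀

  module Ceiling (x d : ℕ) where
    ⌈/⌉ : ℕ
    ⌈/⌉ = (x + d) / suc d

    private
      decomposed : x + d ≡ (x + d) % suc d + ⌈/⌉ * suc d
      decomposed = m≡m%n+[m/n]*n (x + d) (suc d)

    ≤⌈/⌉ : x ≤ ⌈/⌉ * suc d
    ≤⌈/⌉ = +-cancelʳ-≤ d x _ (begin
      x + d                              ≡⟨ decomposed ⟩
      (x + d) % suc d + ⌈/⌉ * suc d      ≤⟨ +-monoˡ-≤ _ (s≤s⁻¹ (m%n<n (x + d) (suc d))) ⟩
      d + ⌈/⌉ * suc d                    ≡⟨ +-comm d _ ⟩
      ⌈/⌉ * suc d + d                    ∎)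
      where open ≤-Reasoning

    ⌈/⌉< : ⌈/⌉ * suc d < x + suc d
    ⌈/⌉< = begin-strict
      ⌈/⌉ * suc d                   ≤⟨ m≤n+m _ ((x + d) % suc d) ⟩
      (x + d) % suc d + ⌈/⌉ * suc d ≡⟨ sym decomposed ⟩
      x + d                         <⟨ +-monoʳ-< x (n<1+n d) ⟩
      x + suc d                     ∎
      where open ≤-Reasoning

  fraction-W₁ : ∀ Δ → 1 ≤ Δ → (ε : ℚ) .{{_ : Positive ε}} (p d : ℕ) → ι (suc d) ℚ.* ε ≡ ι (suc p) →
    ∀ {n m q} (G : Graph n m) (L : Fin m → Subset q) → MaxDegreeAtMost G Δ →
    (∀ e → ι (edeg G e) ℚ.+ ((1ℚ ℚ.+ ε) ℚ.* ι Δ ℚ.+ 1ℚ) ℚ.≤ ι ∣ L e ∣) →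
    ∀ i a b → a ∈ L i → b ∈ L i → W₁≤ (μpin G L i a) (μpin G L i b) (1ℚ ℚ.+ ι 2 ℚ.* (1/ ε) {{ℚ.pos⇒nonZero ε}})
  fraction-W₁ Δ Δ≥1 ε p d Fε G L maxdeg extra =
    pinned-W₁ G L v β F Δ {{>-nonZero β>0}} wide maxdeg ≤⌈/⌉ (scaled-bound ε v F Fε)
    where
    v F : ℕ
    v = suc p
    F = suc d
    open Ceiling (Δ * (v + F)) d renaming (⌈/⌉ to β)
    -- Here Δ ≥ 1 enters; the cancellations of `β` rest on it.
    β>0 : 0 < β
    β>0 = *-cancelʳ-< F 0 β (<-≤-trans (*-mono-≤ Δ≥1 (s≤s {n = p + F} z≤n)) ≤⌈/⌉)
    -- Rounding up adds less than 1 to (1+ε)Δ, and the summand 1 of the hypothesis covers that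
    -- strictly. A strict inequality between integers then leaves room for one more colour, the
    -- `suc` in `suc β`.
    wide : ∀ e → edeg G e + suc β ≤ ∣ L e ∣
    wide e = ≤-trans (≤-reflexive (+-suc (edeg G e) β)) (*-cancelˡ-< F (edeg G e + β) ∣ L e ∣ (begin-strict
      F * (edeg G e + β)                       ≡⟨ *-distribˡ-+ F (edeg G e) β ⟩
      F * edeg G e + F * β                     ≡⟨ cong (λ t → F * edeg G e + t) (*-comm F β) ⟩
      F * edeg G e + β * F                     <⟨ +-monoʳ-< (F * edeg G e) ⌈/⌉< ⟩
      F * edeg G e + (Δ * (v + F) + F)         ≤⟨ cleared ε v F Fε (edeg G e) Δ ∣ L e ∣ (extra e) ⟩
      F * ∣ L e ∣                              ∎))
      where open ≤-Reasoning

open import Data.Nat using (ℕ; _≥_)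
open import Data.Integer using (+_)
open import Data.Rational using (ℚ; Positive; 1ℚ; _+_; _*_; _≤_; _/_; 1/_)
open import Data.Rational.Properties using (pos⇒nonZero)
open import Data.Integer using (+[1+_])
open import Data.Rational using (mkℚ)

theorem4p2 : (Δ : ℕ) → Δ ≥ 1 → (ε : ℚ) → .{{_ : Positive ε}}
    → {n m q : ℕ} (G : Graph n m) (L : Fin m → Subset q)
    → MaxDegreeAtMost G Δ
    → (∀ e → (+ edeg G e / 1) + ((1ℚ + ε) * (+ Δ / 1) + 1ℚ) ≤ (+ ∣ L e ∣ / 1))
    → (i : Fin m) (a b : Fin q) → a ∈ L i → b ∈ L i
    → W₁≤ (μpin G L i a) (μpin G L i b) (1ℚ + (+ 2 / 1) * (1/ ε) {{pos⇒nonZero ε}})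
-- A positive rational has a numerator of the form p + 1 and a denominator d + 1; these become `v`
-- and `F`.
theorem4p2 Δ Δ≥1 ε@(mkℚ +[1+ p ] d c) = Conclusion.fraction-W₁ Δ Δ≥1 ε p d (Fractions.ι-denominator (Data.Nat.suc p) d c)
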